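{- For every integer $k\ge1$ and every $s=0,\dots,k$ the identity $$\sum_{s,k}\frac{k!}{1^{\alpha_1}\alpha_1!\cdots k^{\alpha_k}\alpha_k!}=\sum_{m=1}^{k-s}\ \sum_{m,k-s}C_{\alpha_1,\dots,\alpha_{k-s}}^{k-s,m,k}$$ holds.
   Context: For integers $p,q$, $\sum_{p,q}$ denotes summation over all tuples of nonnegative integers $(\alpha_1,\dots,\alpha_q)$ with $\sum_{i=1}^q\alpha_i=p$ and $\sum_{i=1}^q i\alpha_i=q$. For integers $k\ge1$, $1\le s\le k-1$, $1\le m\le s$ and nonnegative integers $\alpha_1,\dots,\alpha_s$ with $\sum_{i=1}^s\alpha_i=m$, $\sum_{i=1}^s i\alpha_i=s$, the numbers $C_{\alpha_1,\dots,\alpha_s}^{s,m,k}$ are the uniquely determined universal numbers (not depending on $u$) such that for every entire or meromorphic function $u$ on $\mathbb{C}$ the operator $A=u(z)\frac{d}{dz}$ satisfies $$A^{k}=u^k\Big(\frac{d}{dz}\Big)^k+\sum_{s=1}^{k-1}\Big(\sum_{m=1}^{s}u^{k-m}\sum_{m,s}C_{\alpha_1,\dots,\alpha_s}^{s,m,k}\Big(\frac{du}{dz}\Big)^{\alpha_1}\cdots\Big(\frac{d^su}{dz^s}\Big)^{\alpha_s}\Big)\Big(\frac{d}{dz}\Big)^{k-s}.$$ Conventions: when $k-s=0$ the double sum on the right-hand side of the claim is understood to equal $1$ (coefficient of $u^k(d/dz)^k$), and $C_{\alpha_1,\dots,\alpha_k}^{k,m,k}=0$ (the coefficient of $(d/dz)^0$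 in $A^k$ is $0$). -}

module Defs where

open import Algebra.Bundles.Raw using (RawRing)
import Algebra.Definitions.RawSemiring as RawSemiringDefs
open import Data.Integer.Base as ℤ using (+_)
open import Data.List.Base as List using (List; []; _∷_; upTo; concatMap; filter)
open import Data.Nat.Base as ℕ using (ℕ; zero; suc; _∸_; _!; NonZero)
import Data.Nat.Properties as ℕₚ
open import Data.Product.Base using (Σ-syntax; ∃-syntax; _×_; _,_)
open import Data.Rational.Base as ℚ using (ℚ; 0ℚ; 1ℚ; ½)
import Data.Rational.Properties as ℚₚ
open import Data.Rational.Solver using (module +-*-Solver)
open import Data.Unit.Base using (⊤)
open import Data.Vec.Base as Vec using (Vec; []; _∷_)
open import Level using (0ℓ)
open import Relation.Binary.PropositionalEquality
  using (_≡_; refl; sym; trans; cong; subst)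
open import Relation.Nullary.Decidable using (_×-dec_)

------------------------------------------------------------------------
-- Real numbers: Cauchy sequences of rationals, up to _≈ᴿ_

IsCauchy : (ℕ → ℚ) → Set
IsCauchy x = ∀ ε → 0ℚ ℚ.< ε →
  ∃[ N ] (∀ m n → N ℕ.≤ m → N ℕ.≤ n → ℚ.∣ x m ℚ.- x n ∣ ℚ.≤ ε)

private
  module Q = +-*-Solver
  open ℚₚ.≤-Reasoning

-- Abstract so that these proof terms are never unfolded when types are normalised.
abstract
  half-pos : ∀ {ε} → 0ℚ ℚ.< ε → 0ℚ ℚ.< ε ℚ.* ½
  half-pos {ε} 0<ε = ℚₚ.positive⁻¹ (ε ℚ.* ½) {{ℚₚ.pos*pos⇒pos ε {{ℚ.positive 0<ε}} ½}}

  halves : ∀ ε → ε ℚ.* ½ ℚ.+ ε ℚ.* ½ ≡ ε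
  halves ε = trans (sym (ℚₚ.*-distribˡ-+ ε ½ ½)) (ℚₚ.*-identityʳ ε)

  cauchy-const : ∀ q → IsCauchy (λ _ → q)
  cauchy-const q ε 0<ε = 0 , λ _ _ _ _ →
    subst (λ t → ℚ.∣ t ∣ ℚ.≤ ε) (sym (ℚₚ.+-inverseʳ q)) (ℚₚ.<⇒≤ 0<ε)

  cauchy-+ : ∀ {x y} → IsCauchy x → IsCauchy y → IsCauchy (λ n → x n ℚ.+ y n)
  cauchy-+ {x} {y} cx cy ε 0<ε with cx (ε ℚ.* ½) (half-pos 0<ε) | cy (ε ℚ.* ½) (half-pos 0<ε)
  ... | M , hM | N , hN = M ℕ.⊔ N , λ m n p q → begin
    ℚ.∣ (x m ℚ.+ y m) ℚ.- (x n ℚ.+ y n) ∣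
      ≡⟨ cong ℚ.∣_∣ (Q.solve 4 (λ a b c d →
           (a Q.:+ b) Q.:- (c Q.:+ d) Q.:= (a Q.:- c) Q.:+ (b Q.:- d)) refl
           (x m) (y m) (x n) (y n)) ⟩
    ℚ.∣ (x m ℚ.- x n) ℚ.+ (y m ℚ.- y n) ∣
      ≤⟨ ℚₚ.∣p+q∣≤∣p∣+∣q∣ (x m ℚ.- x n) (y m ℚ.- y n) ⟩
    ℚ.∣ x m ℚ.- x n ∣ ℚ.+ ℚ.∣ y m ℚ.- y n ∣
      ≤⟨ ℚₚ.+-mono-≤
           (hM m n (ℕₚ.m⊔n≤o⇒m≤o M N p) (ℕₚ.m⊔n≤o⇒m≤o M N q))
           (hN m n (ℕₚ.m⊔n≤o⇒n≤o M N p) (ℕₚ.m⊔n≤o⇒n≤o M N q)) ⟩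
    ε ℚ.* ½ ℚ.+ ε ℚ.* ½
      ≡⟨ halves ε ⟩
    ε ∎

  cauchy-neg : ∀ {x} → IsCauchy x → IsCauchy (λ n → ℚ.- x n)
  cauchy-neg {x} cx ε 0<ε with cx ε 0<ε
  ... | N , hN = N , λ m n p q → subst (ℚ._≤ ε)
    (trans (sym (ℚₚ.∣-p∣≡∣p∣ (x m ℚ.- x n)))
           (cong ℚ.∣_∣ (ℚₚ.neg-distrib-+ (x m) (ℚ.- x n))))
    (hN m n p q)

  cauchy-bound : ∀ {x} → IsCauchy x →
    ∃[ B ] 0ℚ ℚ.< B × ∃[ N ] (∀ n → N ℕ.≤ n → ℚ.∣ x n ∣ ℚ.≤ B)
  cauchy-bound {x} cx with cx 1ℚ (ℚₚ.positive⁻¹ 1ℚ)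
  ... | N , hN = 1ℚ ℚ.+ ℚ.∣ x N ∣
    , ℚₚ.+-mono-<-≤ (ℚₚ.positive⁻¹ 1ℚ) (ℚₚ.0≤∣p∣ (x N))
    , N , λ n p → begin
    ℚ.∣ x n ∣
      ≡⟨ cong ℚ.∣_∣ (Q.solve 2 (λ a b → a Q.:= (a Q.:- b) Q.:+ b) refl (x n) (x N)) ⟩
    ℚ.∣ (x n ℚ.- x N) ℚ.+ x N ∣
      ≤⟨ ℚₚ.∣p+q∣≤∣p∣+∣q∣ (x n ℚ.- x N) (x N) ⟩
    ℚ.∣ x n ℚ.- x N ∣ ℚ.+ ℚ.∣ x N ∣
      ≤⟨ ℚₚ.+-monoˡ-≤ ℚ.∣ x N ∣ (hN n N p ℕₚ.≤-refl) ⟩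
    1ℚ ℚ.+ ℚ.∣ x N ∣ ∎

  *-mono-abs : ∀ {a b c d} → ℚ.∣ a ∣ ℚ.≤ c → ℚ.∣ b ∣ ℚ.≤ d → ℚ.∣ a ℚ.* b ∣ ℚ.≤ c ℚ.* d
  *-mono-abs {a} {b} {c} {d} a≤c b≤d = begin
    ℚ.∣ a ℚ.* b ∣         ≡⟨ ℚₚ.∣p*q∣≡∣p∣*∣q∣ a b ⟩
    ℚ.∣ a ∣ ℚ.* ℚ.∣ b ∣   ≤⟨ ℚₚ.*-monoʳ-≤-nonNeg ℚ.∣ b ∣ {{ℚₚ.∣-∣-nonNeg b}} a≤c ⟩
    c ℚ.* ℚ.∣ b ∣         ≤⟨ ℚₚ.*-monoˡ-≤-nonNeg c
                              {{ℚ.nonNegative (ℚₚ.≤-trans (ℚₚ.0≤∣p∣ a) a≤c)}} b≤d ⟩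
    c ℚ.* d ∎

  *-difference : ∀ a b c d → a ℚ.* b ℚ.- c ℚ.* d ≡ a ℚ.* (b ℚ.- d) ℚ.+ (a ℚ.- c) ℚ.* d
  *-difference = Q.solve 4 (λ a b c d →
    a Q.:* b Q.:- c Q.:* d Q.:= a Q.:* (b Q.:- d) Q.:+ (a Q.:- c) Q.:* d) refl

  collect : ∀ b c e → (b ℚ.+ c) ℚ.* e ≡ b ℚ.* e ℚ.+ e ℚ.* c
  collect = Q.solve 3 (λ b c e → (b Q.:+ c) Q.:* e Q.:= b Q.:* e Q.:+ e Q.:* c) refl

  product-close : ∀ {a b c d B C δ} → ℚ.∣ a ∣ ℚ.≤ B → ℚ.∣ d ∣ ℚ.≤ C →
    ℚ.∣ a ℚ.- c ∣ ℚ.≤ δ → ℚ.∣ b ℚ.- d ∣ ℚ.≤ δ →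
    ℚ.∣ a ℚ.* b ℚ.- c ℚ.* d ∣ ℚ.≤ B ℚ.* δ ℚ.+ δ ℚ.* C
  product-close {a} {b} {c} {d} {B} {C} {δ} a≤B d≤C ac bd = begin
    ℚ.∣ a ℚ.* b ℚ.- c ℚ.* d ∣
      ≡⟨ cong ℚ.∣_∣ (*-difference a b c d) ⟩
    ℚ.∣ a ℚ.* (b ℚ.- d) ℚ.+ (a ℚ.- c) ℚ.* d ∣
      ≤⟨ ℚₚ.∣p+q∣≤∣p∣+∣q∣ (a ℚ.* (b ℚ.- d)) ((a ℚ.- c) ℚ.* d) ⟩
    ℚ.∣ a ℚ.* (b ℚ.- d) ∣ ℚ.+ ℚ.∣ (a ℚ.- c) ℚ.* d ∣
      ≤⟨ ℚₚ.+-mono-≤ (*-mono-abs {a} {b ℚ.- d} a≤B bd) (*-mono-abs {a ℚ.- c} {d} ac d≤C) ⟩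
    B ℚ.* δ ℚ.+ δ ℚ.* C ∎

  split-ε : ∀ {K ε} → 0ℚ ℚ.< K → 0ℚ ℚ.< ε → ∃[ δ ] 0ℚ ℚ.< δ × ε ≡ K ℚ.* δ
  split-ε {K} {ε} 0<K 0<ε =
    ε ℚ.* ℚ.1/ K
    , ℚₚ.positive⁻¹ (ε ℚ.* ℚ.1/ K) {{ℚₚ.pos*pos⇒pos ε {{ℚ.positive 0<ε}} (ℚ.1/ K) {{ℚₚ.1/pos⇒pos K}}}}
    , sym (trans (rearrange K ε (ℚ.1/ K))
                 (trans (cong (ε ℚ.*_) (ℚₚ.*-inverseʳ K)) (ℚₚ.*-identityʳ ε)))
    where
    instance
      K-pos : ℚ.Positive K
      K-pos = ℚ.positive 0<K
      K-nonZero : ℚ.NonZero K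
      K-nonZero = ℚₚ.pos⇒nonZero K
    rearrange : ∀ a b c → a ℚ.* (b ℚ.* c) ≡ b ℚ.* (a ℚ.* c)
    rearrange = Q.solve 3 (λ a b c → a Q.:* (b Q.:* c) Q.:= b Q.:* (a Q.:* c)) refl

  cauchy-* : ∀ {x y} → IsCauchy x → IsCauchy y → IsCauchy (λ n → x n ℚ.* y n)
  cauchy-* {x} {y} cx cy ε 0<ε =
    let B , 0<B , L , hL    = cauchy-bound {x} cx
        C , 0<C , L′ , hL′  = cauchy-bound {y} cy
        δ , 0<δ , ε≡        = split-ε {B ℚ.+ C} {ε} (ℚₚ.+-mono-< {0ℚ} {B} {0ℚ} {C} 0<B 0<C) 0<ε
        M , hM              = cx δ 0<δ
        N , hN              = cy δ 0<δ
    in (M ℕ.⊔ N) ℕ.⊔ (L ℕ.⊔ L′) , λ m n p q →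
    let pMN = ℕₚ.m⊔n≤o⇒m≤o (M ℕ.⊔ N) (L ℕ.⊔ L′) p
        qMN = ℕₚ.m⊔n≤o⇒m≤o (M ℕ.⊔ N) (L ℕ.⊔ L′) q
        pL  = ℕₚ.m⊔n≤o⇒m≤o L L′ (ℕₚ.m⊔n≤o⇒n≤o (M ℕ.⊔ N) (L ℕ.⊔ L′) p)
        qL′ = ℕₚ.m⊔n≤o⇒n≤o L L′ (ℕₚ.m⊔n≤o⇒n≤o (M ℕ.⊔ N) (L ℕ.⊔ L′) q)
    in subst (ℚ.∣ x m ℚ.* y m ℚ.- x n ℚ.* y n ∣ ℚ.≤_)
         (sym (trans ε≡ (collect B C δ)))
         (product-close {x m} {y m} {x n} {y n} {B} {C} {δ} (hL m pL) (hL′ n qL′)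
           (hM m n (ℕₚ.m⊔n≤o⇒m≤o M N pMN) (ℕₚ.m⊔n≤o⇒m≤o M N qMN))
           (hN m n (ℕₚ.m⊔n≤o⇒n≤o M N pMN) (ℕₚ.m⊔n≤o⇒n≤o M N qMN)))

record ℝ : Set where
  constructor mkℝ
  field
    seq    : ℕ → ℚ
    cauchy : IsCauchy seq
open ℝ public

infix  4 _≈ᴿ_ _≤ᴿ_ _<ᴿ_
infixl 6 _+ᴿ_
infixl 7 _*ᴿ_
infix  8 -ᴿ_

_≈ᴿ_ _≤ᴿ_ _<ᴿ_ : ℝ → ℝ → Set
x ≈ᴿ y = ∀ ε → 0ℚ ℚ.< ε → ∃[ N ] (∀ n → N ℕ.≤ n → ℚ.∣ seq x n ℚ.- seq y n ∣ ℚ.≤ ε)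
x ≤ᴿ y = ∀ ε → 0ℚ ℚ.< ε → ∃[ N ] (∀ n → N ℕ.≤ n → seq x n ℚ.≤ seq y n ℚ.+ ε)
x <ᴿ y = ∃[ ε ] 0ℚ ℚ.< ε × ∃[ N ] (∀ n → N ℕ.≤ n → seq x n ℚ.+ ε ℚ.≤ seq y n)

fromℚᴿ : ℚ → ℝ
fromℚᴿ q = mkℝ (λ _ → q) (cauchy-const q)

_+ᴿ_ _*ᴿ_ : ℝ → ℝ → ℝ
x +ᴿ y = mkℝ (λ n → seq x n ℚ.+ seq y n) (cauchy-+ {seq x} {seq y} (cauchy x) (cauchy y))
x *ᴿ y = mkℝ (λ n → seq x n ℚ.* seq y n) (cauchy-* {seq x} {seq y} (cauchy x) (cauchy y))

-ᴿ_ : ℝ → ℝ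
-ᴿ x = mkℝ (λ n → ℚ.- seq x n) (cauchy-neg {seq x} (cauchy x))

------------------------------------------------------------------------
-- Complex numbers

record ℂ : Set where
  constructor _+i_
  field
    re im : ℝ
open ℂ public

infix  4 _≈_
infixl 6 _+_ _-_
infixl 7 _*_
infix  8 -_

_≈_ : ℂ → ℂ → Set
z ≈ w = (re z ≈ᴿ re w) × (im z ≈ᴿ im w)

_+_ _*_ : ℂ → ℂ → ℂ
z + w = (re z +ᴿ re w) +i (im z +ᴿ im w)
z * w = (re z *ᴿ re w +ᴿ -ᴿ (im z *ᴿ im w)) +i (re z *ᴿ im w +ᴿ im z *ᴿ re w)

-_ : ℂ → ℂ
- z = (-ᴿ re z) +i (-ᴿ im z)

_-_ : ℂ → ℂ → ℂ
z - w = z + (- w)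

fromℚ : ℚ → ℂ
fromℚ q = fromℚᴿ q +i fromℚᴿ 0ℚ

0# 1# : ℂ
0# = fromℚ 0ℚ
1# = fromℚ 1ℚ

ℂ-rawRing : RawRing 0ℓ 0ℓ
ℂ-rawRing = record
  { Carrier = ℂ ; _≈_ = _≈_ ; _+_ = _+_ ; _*_ = _*_ ; -_ = -_ ; 0# = 0# ; 1# = 1# }

open RawSemiringDefs (RawRing.rawSemiring ℂ-rawRing) public using (_^_)

∣_∣² : ℂ → ℝ
∣ z ∣² = re z *ᴿ re z +ᴿ im z *ᴿ im z

∑ : ∀ {A : Set} → List A → (A → ℂ) → ℂ
∑ xs F = List.foldr (λ x acc → F x + acc) 0# xs

-- ∑[1… n ] F is F 1 + ⋯ + F n.
∑[1…_] : ℕ → (ℕ → ℂ) → ℂ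
∑[1… n ] F = ∑ (upTo n) (λ i → F (suc i))

------------------------------------------------------------------------
-- Complex functions and holomorphy

-- Inequalities ∣a∣ ≤ ∣b∣ between moduli are written ∣a∣² ≤ ∣b∣² throughout,
-- which avoids square roots.

Disc : ℂ → ℚ → ℂ → Set
Disc a r z = ∣ z - a ∣² <ᴿ fromℚᴿ (r ℚ.* r)

PuncturedDisc : ℂ → ℚ → ℂ → Set
PuncturedDisc a r z = (fromℚᴿ 0ℚ <ᴿ ∣ z - a ∣²) × Disc a r z

IsOpen : (ℂ → Set) → Set
IsOpen Ω = ∀ a → Ω a → ∃[ r ] 0ℚ ℚ.< r × (∀ z → Disc a r z → Ω z)

record Fun (Ω : ℂ → Set) : Set where
  field
    at      : ∀ z → Ω z → ℂ
    at-cong : ∀ {z w} (p : Ω z) (q : Ω w) → z ≈ w → at z p ≈ at w q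
open Fun public

HasDerivative : ∀ {Ω} → Fun Ω → Fun Ω → Set
HasDerivative {Ω} f f′ = ∀ z (p : Ω z) ε → 0ℚ ℚ.< ε →
  ∃[ δ ] 0ℚ ℚ.< δ × (∀ w (q : Ω w) →
    ∣ w - z ∣² ≤ᴿ fromℚᴿ (δ ℚ.* δ) →
    ∣ at f w q - at f z p - at f′ z p * (w - z) ∣² ≤ᴿ fromℚᴿ (ε ℚ.* ε) *ᴿ ∣ w - z ∣²)

-- The successive complex derivatives are part of the data.  Classically every
-- once complex differentiable function on an open set has them, and has only
-- one choice of them up to _≈_.  The Ω of interest are all open.
record Holomorphic (Ω : ℂ → Set) : Set where
  field
    deriv    : ℕ → Fun Ω
    is-deriv : ∀ n → HasDerivative (deriv n) (deriv (suc n))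

  fun : Fun Ω
  fun = deriv 0
open Holomorphic public

Everywhere : ℂ → Set
Everywhere _ = ⊤

Entire : Set
Entire = Holomorphic Everywhere

-- A function u holomorphic on the open set Ω has at most isolated poles outside
-- it: around every a ∈ ℂ some (z - a)ⁿ u(z) extends holomorphically across a.
record IsMeromorphic (Ω : ℂ → Set) (u : Holomorphic Ω) : Set where
  field
    is-open : IsOpen Ω
    pole-at : ∀ a →
      ∃[ r ] 0ℚ ℚ.< r ×
      (∀ z → PuncturedDisc a r z → Ω z) ×
      ∃[ n ] (Σ[ g ∈ Holomorphic (Disc a r) ]
        (∀ z (p : Ω z) (q : Disc a r z) → (z - a) ^ n * at (fun u) z p ≈ at (fun g) z q))

-- A^[ u , k ] f ↦ h  says that h = Aᵏ f where A = u · d/dz.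
data A^[_,_]_↦_ {Ω : ℂ → Set} (u : Fun Ω) : ℕ → Fun Ω → Fun Ω → Set where
  A^0   : {f h : Fun Ω} → ((z : ℂ) (p : Ω z) → at h z p ≈ at f z p) → A^[ u , 0 ] f ↦ h
  A^suc : {k : ℕ} {f g g′ h : Fun Ω} → A^[ u , k ] f ↦ g → HasDerivative g g′ →
          ((z : ℂ) (p : Ω z) → at h z p ≈ at u z p * at g′ z p) → A^[ u , suc k ] f ↦ h

------------------------------------------------------------------------
-- The tuples (α₁, …, α_q) and the expressions indexed by them

-- In the following, the entries of the vector are α_i, α_{i+1}, ….

weight : ∀ {n} → ℕ → Vec ℕ n → ℕ
weight i []      = 0
weight i (a ∷ α) = i ℕ.* a ℕ.+ weight (suc i) α

denominator : ∀ {n} → ℕ → Vec ℕ n → ℕ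
denominator i []      = 1
denominator i (a ∷ α) = (i ℕ.^ a ℕ.* a !) ℕ.* denominator (suc i) α

denominator≢0 : ∀ {n} i .{{_ : NonZero i}} (α : Vec ℕ n) → NonZero (denominator i α)
denominator≢0 i []      = _
denominator≢0 i (a ∷ α) =
  ℕₚ.m*n≢0 (i ℕ.^ a ℕ.* a !) _
    {{ℕₚ.m*n≢0 (i ℕ.^ a) (a !) {{ℕₚ.m^n≢0 i a}} {{a ℕₚ.!≢0}}}}
    {{denominator≢0 (suc i) α}}

monomial : ∀ {n Ω} → Holomorphic Ω → ℕ → Vec ℕ n → ∀ z → Ω z → ℂ
monomial u i []      z p = 1#
monomial u i (a ∷ α) z p = at (deriv u i) z p ^ a * monomial u (suc i) α z p

vectorsUpTo : ℕ → ∀ n → List (Vec ℕ n)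
vectorsUpTo b zero    = [] ∷ []
vectorsUpTo b (suc n) = concatMap (λ a → List.map (a ∷_) (vectorsUpTo b n)) (upTo (suc b))

-- The index set of ∑_{p,q}.  Entries are at most p because they sum to p.
tuples : ℕ → ∀ q → List (Vec ℕ q)
tuples p q = filter (λ α → (Vec.sum α ℕₚ.≟ p) ×-dec (weight 1 α ℕₚ.≟ q)) (vectorsUpTo p q)

cycleTerm : ∀ k → Vec ℕ k → ℚ
cycleTerm k α = (ℤ.+ (k !) ℚ./ denominator 1 α) {{denominator≢0 1 α}}

------------------------------------------------------------------------
-- The universal coefficients

-- C k s m α stands for the number with upper indices s, m, k and lower indices α.
Coefficients : Set
Coefficients = (k s m : ℕ) → Vec ℕ s → ℂ

expansion : ∀ {Ω} → Coefficients → ℕ → (u f : Holomorphic Ω) → ∀ z → Ω z → ℂ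
expansion C k u f z p =
  at (fun u) z p ^ k * at (deriv f k) z p
  + ∑[1… k ∸ 1 ] (λ s →
      ∑[1… s ] (λ m →
        at (fun u) z p ^ (k ∸ m) * ∑ (tuples m s) (λ α → C k s m α * monomial u 1 α z p))
      * at (deriv f (k ∸ s)) z p)

-- Aᵏ = expansion, as operators on functions holomorphic off the poles of u.
OperatorIdentity : Coefficients → (Ω : ℂ → Set) → Holomorphic Ω → ℕ → Set
OperatorIdentity C Ω u k = ∀ (f : Holomorphic Ω) (h : Fun Ω) →
  A^[ fun u , k ] fun f ↦ h → ∀ z p → at h z p ≈ expansion C k u f z p

-- The convention covers s = k, outside the range 1 ≤ s ≤ k - 1 where the
-- operator identity determines the coefficients.
record IsUniversal (C : Coefficients) : Set₁ where
  field
    entire      : ∀ k → 1 ℕ.≤ k → (u : Entire) → OperatorIdentity C Everywhere u k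
    meromorphic : ∀ k → 1 ℕ.≤ k → (Ω : ℂ → Set) (u : Holomorphic Ω) → IsMeromorphic Ω u →
                  OperatorIdentity C Ω u k
    convention  : ∀ k m → 1 ℕ.≤ k → 1 ℕ.≤ m → m ℕ.≤ k → (α : Vec ℕ k) →
                  Vec.sum α ≡ m → weight 1 α ≡ k → C k k m α ≈ 0#

-- The double sum ∑_{m=1}^{j} ∑_{m,j} C k j m α, with the convention that it is 1
-- when j = 0 (the coefficient of uᵏ (d/dz)ᵏ in Aᵏ).
doubleSum : Coefficients → ℕ → ℕ → ℂ
doubleSum C k zero      = 1#
doubleSum C k j@(suc _) = ∑[1… j ] (λ m → ∑ (tuples m j) (λ α → C k j m α))

{-# OPTIONS --safe #-}
-- Both sides are the unsigned Stirling number of the first kind c(k,s).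
--
-- Right-hand side: take u = ∑_{i≤k} zⁱ/i! and f = zˢ/s!.  At 0 all monomials in the
-- derivatives of u of order at most k equal 1, so Aᵏ f (0) is the double sum.  As far
-- as these derivatives are concerned u is e^z, and (e^z D)ᵏ = e^{kz} D (D+1) ⋯ (D+k-1),
-- so Aᵏ f (0) is the coefficient of Dˢ in D (D+1) ⋯ (D+k-1).
--
-- Left-hand side: the tuple sum is k! times the coefficient of tˢ xᵏ in
-- F = ∏ⱼ exp(t xʲ/j).  Since x ∂F/∂x = F ∑ⱼ t xʲ, multiplying by 1 - x gives the
-- recurrence c(k+1,s) = k c(k,s) + c(k,s-1).
module Submission where

open import Algebra.Bundles using (CommutativeRing)
import Algebra.Solver.Ring.AlmostCommutativeRing as ACR
import Algebra.Solver.Ring.Simple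
open import Data.Bool.Base using (true; false; if_then_else_)
open import Data.Integer.Base as ℤ using ()
import Data.Integer.Properties as ℤₚ
open import Data.List.Base as List using (List; []; _∷_; _++_; upTo; applyUpTo; concatMap; filter)
import Data.List.Properties as Listₚ
open import Data.List.Relation.Unary.All as All using (All; []; _∷_)
import Data.List.Relation.Unary.All.Properties as Allₚ
open import Data.Nat.Base using (ℕ; _≤_; _∸_)
open import Data.Nat.Base as ℕ using (zero; suc; _<_; _!; NonZero; z≤n; s≤s; s<s)
import Data.Nat.Properties as ℕₚ
import Data.Nat.Solver
open import Data.Product.Base using (_×_; _,_; proj₁; proj₂; ∃-syntax; map₂)
import Data.Product.Properties as Productₚ
open import Data.Rational.Base as ℚ using (ℚ; 0ℚ; 1ℚ)
import Data.Rational.Properties as ℚₚ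
open import Data.Rational.Solver using (module +-*-Solver)
open import Data.Rational.Unnormalised.Base as ℚᵘ using (mkℚᵘ)
import Data.Rational.Unnormalised.Properties as ℚᵘₚ
open import Data.Sum.Base using (_⊎_; inj₁; inj₂)
open import Data.Unit.Base using (tt)
open import Data.Vec.Base as Vec using (Vec; []; _∷_)
open import Defs
open import Function.Base using (_∘_; id)
open import Level using (0ℓ)
open import Relation.Binary.PropositionalEquality
open import Relation.Nullary.Decidable using (Dec; yes; no; does; _×-dec_)
open import Relation.Nullary.Negation using (contradiction)
open import Relation.Unary using (Pred; Decidable)

-- Taking u = eᶻ itself would call for power series over Cauchy reals and estimates for all their
-- derivatives. A truncation is enough because Aᵏ f (0) depends on finitely many derivatives of u at
-- 0. Polynomials are also closed under d/dz and under multiplication by u, so every iterate of A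
-- has an explicit derivative. Their differentiability comes down to an exact Taylor identity over
-- ℚ[i], since the operations of ℂ act termwise on the approximating sequences.
--
-- The other side is truncated as well. The tuples are filtered from vectors with entries at most s,
-- so each exponential is cut after degree s in t, and the differential equation for F holds only
-- modulo a power of t. Likewise only the factors with j ≤ k are present, so the recurrence in the
-- x-degree is available only up to xᵏ. Both ranges just reach the coefficient that is wanted.
--
-- The evaluation at 0 covers 1 ≤ s < k; the two ends are settled by the conventions.

private
  module Q = +-*-Solver
  module N = Data.Nat.Solver.+-*-Solver
  variable
    A B : Set

-- Rational arithmetic and finite sums

ι : ℕ → ℚ
ι n = ℤ.+ n ℚ./ 1

toℚᵘ-ι : ∀ n → ℚ.toℚᵘ (ι n) ℚᵘ.≃ mkℚᵘ (ℤ.+ n) 0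
toℚᵘ-ι n = ℚₚ.toℚᵘ-fromℚᵘ (mkℚᵘ (ℤ.+ n) 0)

ι-suc : ∀ n → ι (suc n) ≡ 1ℚ ℚ.+ ι n
ι-suc n = ℚₚ.toℚᵘ-injective (begin
  ℚ.toℚᵘ (ι (suc n))                   ≈⟨ toℚᵘ-ι (suc n) ⟩
  mkℚᵘ (ℤ.+ suc n) 0                   ≈⟨ ℚᵘ.*≡* (cong (λ z → (ℤ.1ℤ ℤ.+ z) ℤ.* ℤ.1ℤ) (sym (ℤₚ.*-identityʳ (ℤ.+ n)))) ⟩
  ℚᵘ.1ℚᵘ ℚᵘ.+ mkℚᵘ (ℤ.+ n) 0           ≈⟨ ℚᵘₚ.+-congʳ ℚᵘ.1ℚᵘ (ℚᵘₚ.≃-sym (toℚᵘ-ι n)) ⟩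
  ℚᵘ.1ℚᵘ ℚᵘ.+ ℚ.toℚᵘ (ι n)             ≈⟨ ℚᵘₚ.≃-sym (ℚₚ.toℚᵘ-homo-+ 1ℚ (ι n)) ⟩
  ℚ.toℚᵘ (1ℚ ℚ.+ ι n)                  ∎)
  where open ℚᵘₚ.≃-Reasoning

ι-+ : ∀ m n → ι (m ℕ.+ n) ≡ ι m ℚ.+ ι n
ι-+ zero    n = sym (ℚₚ.+-identityˡ (ι n))
ι-+ (suc m) n = begin
  ι (suc (m ℕ.+ n))          ≡⟨ ι-suc (m ℕ.+ n) ⟩
  1ℚ ℚ.+ ι (m ℕ.+ n)         ≡⟨ cong (1ℚ ℚ.+_) (ι-+ m n) ⟩
  1ℚ ℚ.+ (ι m ℚ.+ ι n)       ≡⟨ ℚₚ.+-assoc 1ℚ (ι m) (ι n) ⟨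
  1ℚ ℚ.+ ι m ℚ.+ ι n         ≡⟨ cong (ℚ._+ ι n) (ι-suc m) ⟨
  ι (suc m) ℚ.+ ι n          ∎
  where open ≡-Reasoning

ι-* : ∀ m n → ι (m ℕ.* n) ≡ ι m ℚ.* ι n
ι-* zero    n = sym (ℚₚ.*-zeroˡ (ι n))
ι-* (suc m) n = begin
  ι (n ℕ.+ m ℕ.* n)          ≡⟨ ι-+ n (m ℕ.* n) ⟩
  ι n ℚ.+ ι (m ℕ.* n)        ≡⟨ cong (ι n ℚ.+_) (ι-* m n) ⟩
  ι n ℚ.+ ι m ℚ.* ι n        ≡⟨ Q.solve 2 (λ a b → b Q.:+ a Q.:* b Q.:= (Q.con 1ℚ Q.:+ a) Q.:* b) refl (ι m) (ι n) ⟩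
  (1ℚ ℚ.+ ι m) ℚ.* ι n       ≡⟨ cong (ℚ._* ι n) (ι-suc m) ⟨
  ι (suc m) ℚ.* ι n          ∎
  where open ≡-Reasoning

*-ι-cancel : ∀ z n .{{_ : NonZero n}} → (z ℚ./ n) ℚ.* ι n ≡ z ℚ./ 1
*-ι-cancel z n@(suc n-1) = ℚₚ.toℚᵘ-injective (begin
  ℚ.toℚᵘ ((z ℚ./ n) ℚ.* ι n)               ≈⟨ ℚₚ.toℚᵘ-homo-* (z ℚ./ n) (ι n) ⟩
  ℚ.toℚᵘ (z ℚ./ n) ℚᵘ.* ℚ.toℚᵘ (ι n)       ≈⟨ ℚᵘₚ.*-cong (ℚₚ.toℚᵘ-fromℚᵘ (mkℚᵘ z n-1)) (toℚᵘ-ι n) ⟩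
  mkℚᵘ z n-1 ℚᵘ.* mkℚᵘ (ℤ.+ n) 0           ≈⟨ ℚᵘ.*≡* (trans (ℤₚ.*-identityʳ (z ℤ.* ℤ.+ n)) (cong (λ m → z ℤ.* ℤ.+ m) (sym (ℕₚ.*-identityʳ n)))) ⟩
  mkℚᵘ z 0                                 ≈⟨ ℚᵘₚ.≃-sym (ℚₚ.toℚᵘ-fromℚᵘ (mkℚᵘ z 0)) ⟩
  ℚ.toℚᵘ (z ℚ./ 1)                         ∎)
  where open ℚᵘₚ.≃-Reasoning

-- The value at 0 makes it total, so reciprocals of denominators can be written inside sums without
-- nonzeroness proofs.
recip : ℕ → ℚ
recip zero      = 0ℚ
recip n@(suc _) = ℤ.1ℤ ℚ./ n

recip-inverse : ∀ n .{{_ : NonZero n}} → ι n ℚ.* recip n ≡ 1ℚ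
recip-inverse n@(suc _) = trans (ℚₚ.*-comm (ι n) (recip n)) (*-ι-cancel ℤ.1ℤ n)

recip-unique : ∀ n .{{_ : NonZero n}} q → q ℚ.* ι n ≡ 1ℚ → q ≡ recip n
recip-unique n q q*n≡1 = begin
  q                          ≡⟨ ℚₚ.*-identityʳ q ⟨
  q ℚ.* 1ℚ                   ≡⟨ cong (q ℚ.*_) (recip-inverse n) ⟨
  q ℚ.* (ι n ℚ.* recip n)    ≡⟨ ℚₚ.*-assoc q (ι n) (recip n) ⟨
  q ℚ.* ι n ℚ.* recip n      ≡⟨ cong (ℚ._* recip n) q*n≡1 ⟩
  1ℚ ℚ.* recip n             ≡⟨ ℚₚ.*-identityˡ (recip n) ⟩
  recip n                    ∎
  where open ≡-Reasoning

recip-* : ∀ m n .{{_ : NonZero m}} .{{_ : NonZero n}} → recip (m ℕ.* n) ≡ recip m ℚ.* recip n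
recip-* m n = sym (recip-unique (m ℕ.* n) {{ℕₚ.m*n≢0 m n}} (recip m ℚ.* recip n) (begin
  recip m ℚ.* recip n ℚ.* ι (m ℕ.* n)            ≡⟨ cong (recip m ℚ.* recip n ℚ.*_) (ι-* m n) ⟩
  recip m ℚ.* recip n ℚ.* (ι m ℚ.* ι n)
    ≡⟨ Q.solve 4 (λ a b c d → (c Q.:* d) Q.:* (a Q.:* b) Q.:= (a Q.:* c) Q.:* (b Q.:* d)) refl (ι m) (ι n) (recip m) (recip n) ⟩
  ι m ℚ.* recip m ℚ.* (ι n ℚ.* recip n)          ≡⟨ cong₂ ℚ._*_ (recip-inverse m) (recip-inverse n) ⟩
  1ℚ                                             ∎))
  where open ≡-Reasoning

/≡*-recip : ∀ m n .{{_ : NonZero n}} → ℤ.+ m ℚ./ n ≡ ι m ℚ.* recip n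
/≡*-recip m n = begin
  p                            ≡⟨ ℚₚ.*-identityʳ p ⟨
  p ℚ.* 1ℚ                     ≡⟨ cong (p ℚ.*_) (recip-inverse n) ⟨
  p ℚ.* (ι n ℚ.* recip n)      ≡⟨ ℚₚ.*-assoc p (ι n) (recip n) ⟨
  p ℚ.* ι n ℚ.* recip n        ≡⟨ cong (ℚ._* recip n) (*-ι-cancel (ℤ.+ m) n) ⟩
  ι m ℚ.* recip n              ∎
  where
  open ≡-Reasoning
  p = ℤ.+ m ℚ./ n

∑ℚ : List A → (A → ℚ) → ℚ
∑ℚ xs f = List.foldr (λ x acc → f x ℚ.+ acc) 0ℚ xs

∑ℚ-cong : ∀ (xs : List A) {f g} → (∀ x → f x ≡ g x) → ∑ℚ xs f ≡ ∑ℚ xs g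
∑ℚ-cong []       f≗g = refl
∑ℚ-cong (x ∷ xs) f≗g = cong₂ ℚ._+_ (f≗g x) (∑ℚ-cong xs f≗g)

∑ℚ-zero : ∀ (xs : List A) → ∑ℚ xs (λ _ → 0ℚ) ≡ 0ℚ
∑ℚ-zero []       = refl
∑ℚ-zero (x ∷ xs) = trans (ℚₚ.+-identityˡ _) (∑ℚ-zero xs)

∑ℚ-+ : ∀ (xs : List A) f g → ∑ℚ xs (λ x → f x ℚ.+ g x) ≡ ∑ℚ xs f ℚ.+ ∑ℚ xs g
∑ℚ-+ []       f g = refl
∑ℚ-+ (x ∷ xs) f g = trans (cong (f x ℚ.+ g x ℚ.+_) (∑ℚ-+ xs f g))
  (Q.solve 4 (λ a b c d → (a Q.:+ b) Q.:+ (c Q.:+ d) Q.:= (a Q.:+ c) Q.:+ (b Q.:+ d)) refl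
    (f x) (g x) (∑ℚ xs f) (∑ℚ xs g))

∑ℚ-*ˡ : ∀ (xs : List A) c f → ∑ℚ xs (λ x → c ℚ.* f x) ≡ c ℚ.* ∑ℚ xs f
∑ℚ-*ˡ []       c f = sym (ℚₚ.*-zeroʳ c)
∑ℚ-*ˡ (x ∷ xs) c f = trans (cong (c ℚ.* f x ℚ.+_) (∑ℚ-*ˡ xs c f)) (sym (ℚₚ.*-distribˡ-+ c (f x) (∑ℚ xs f)))

∑ℚ-++ : ∀ (xs ys : List A) f → ∑ℚ (xs ++ ys) f ≡ ∑ℚ xs f ℚ.+ ∑ℚ ys f
∑ℚ-++ []       ys f = sym (ℚₚ.+-identityˡ _)
∑ℚ-++ (x ∷ xs) ys f = trans (cong (f x ℚ.+_) (∑ℚ-++ xs ys f)) (sym (ℚₚ.+-assoc (f x) (∑ℚ xs f) (∑ℚ ys f)))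

∑ℚ-swap : ∀ (xs : List A) (ys : List B) (f : A → B → ℚ) →
          ∑ℚ xs (λ x → ∑ℚ ys (λ y → f x y)) ≡ ∑ℚ ys (λ y → ∑ℚ xs (λ x → f x y))
∑ℚ-swap []       ys f = sym (∑ℚ-zero ys)
∑ℚ-swap (x ∷ xs) ys f = trans (cong (∑ℚ ys (f x) ℚ.+_) (∑ℚ-swap xs ys f)) (sym (∑ℚ-+ ys (f x) (λ y → ∑ℚ xs (λ x → f x y))))

∑ℚ-map : ∀ (g : B → A) xs f → ∑ℚ (List.map g xs) f ≡ ∑ℚ xs (f ∘ g)
∑ℚ-map g []       f = refl
∑ℚ-map g (x ∷ xs) f = cong (f (g x) ℚ.+_) (∑ℚ-map g xs f)

∑ℚ-concatMap : ∀ (g : B → List A) xs f → ∑ℚ (concatMap g xs) f ≡ ∑ℚ xs (λ x → ∑ℚ (g x) f)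
∑ℚ-concatMap g []       f = refl
∑ℚ-concatMap g (x ∷ xs) f =
  trans (∑ℚ-++ (g x) (concatMap g xs) f) (cong (∑ℚ (g x) f ℚ.+_) (∑ℚ-concatMap g xs f))

-- Turns the side conditions on a tuple into a 0-1 factor, which `δ-does` then identifies with a
-- coefficient of a monomial in t and x.
∑ℚ-filter : ∀ {P : Pred A 0ℓ} (P? : Decidable P) xs f →
            ∑ℚ (filter P? xs) f ≡ ∑ℚ xs (λ x → f x ℚ.* (if does (P? x) then 1ℚ else 0ℚ))
∑ℚ-filter P? []       f = refl
∑ℚ-filter P? (x ∷ xs) f with does (P? x)
... | true  = cong₂ ℚ._+_ (sym (ℚₚ.*-identityʳ (f x))) (∑ℚ-filter P? xs f)
... | false = trans (∑ℚ-filter P? xs f)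
  (trans (sym (ℚₚ.+-identityˡ _)) (cong (ℚ._+ _) (sym (ℚₚ.*-zeroʳ (f x)))))

∑ℚ-applyUpTo : ∀ (g : ℕ → A) n f → ∑ℚ (applyUpTo g n) f ≡ ∑ℚ (upTo n) (f ∘ g)
∑ℚ-applyUpTo g n f = trans (cong (λ xs → ∑ℚ xs f) (sym (Listₚ.map-upTo g n))) (∑ℚ-map g (upTo n) f)

∑ℚ-upTo-first : ∀ n f → ∑ℚ (upTo (suc n)) f ≡ f 0 ℚ.+ ∑ℚ (upTo n) (f ∘ suc)
∑ℚ-upTo-first n f = cong (f 0 ℚ.+_) (∑ℚ-applyUpTo suc n f)

∑ℚ-upTo-last : ∀ n f → ∑ℚ (upTo (suc n)) f ≡ ∑ℚ (upTo n) f ℚ.+ f n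
∑ℚ-upTo-last n f = begin
  ∑ℚ (upTo (suc n)) f              ≡⟨ cong (λ xs → ∑ℚ xs f) (Listₚ.upTo-∷ʳ n) ⟨
  ∑ℚ (upTo n ++ n ∷ []) f          ≡⟨ ∑ℚ-++ (upTo n) (n ∷ []) f ⟩
  ∑ℚ (upTo n) f ℚ.+ (f n ℚ.+ 0ℚ)   ≡⟨ cong (∑ℚ (upTo n) f ℚ.+_) (ℚₚ.+-identityʳ (f n)) ⟩
  ∑ℚ (upTo n) f ℚ.+ f n            ∎
  where open ≡-Reasoning

δ : ℕ → ℕ → ℚ
δ zero    zero    = 1ℚ
δ zero    (suc _) = 0ℚ
δ (suc _) zero    = 0ℚ
δ (suc m) (suc n) = δ m n

δ-diagonal : ∀ n → δ n n ≡ 1ℚ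
δ-diagonal zero    = refl
δ-diagonal (suc n) = δ-diagonal n

δ-off-diagonal : ∀ {m n} → m ≢ n → δ m n ≡ 0ℚ
δ-off-diagonal {zero}  {zero}  0≢0 = contradiction refl 0≢0
δ-off-diagonal {zero}  {suc n} _   = refl
δ-off-diagonal {suc m} {zero}  _   = refl
δ-off-diagonal {suc m} {suc n} m≢n = δ-off-diagonal (m≢n ∘ cong suc)

δ-does : ∀ m n m′ n′ → (if does ((m ℕₚ.≟ n) ×-dec (m′ ℕₚ.≟ n′)) then 1ℚ else 0ℚ) ≡ δ m n ℚ.* δ m′ n′
δ-does m n m′ n′ = by-cases (m ℕₚ.≟ n) (m′ ℕₚ.≟ n′)
  where
  by-cases : ∀ d d′ → (if does {A = m ≡ n × m′ ≡ n′} (d ×-dec d′) then 1ℚ else 0ℚ) ≡ δ m n ℚ.* δ m′ n′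
  by-cases (yes refl) (yes refl) = sym (cong₂ ℚ._*_ (δ-diagonal m) (δ-diagonal m′))
  by-cases (yes refl) (no m′≢n′) = sym (trans (cong (δ m m ℚ.*_) (δ-off-diagonal m′≢n′)) (ℚₚ.*-zeroʳ (δ m m)))
  by-cases (no m≢n)   _          = sym (trans (cong (ℚ._* δ m′ n′) (δ-off-diagonal m≢n)) (ℚₚ.*-zeroˡ (δ m′ n′)))

-- The cycle index series

-- Coefficient arrays of power series: F s w is the coefficient of tˢ xʷ.
Series : Set
Series = ℕ → ℕ → ℚ

-- Multiplication by xᵖ on the coefficient sequence of a power series.
down : ℕ → (ℕ → ℚ) → ℕ → ℚ
down zero    f n       = f n
down (suc p) f zero    = 0ℚ
down (suc p) f (suc n) = down p f n

down-cong : ∀ p n {f g} → (∀ n → f n ≡ g n) → down p f n ≡ down p g n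
down-cong zero    n       f≗g = f≗g n
down-cong (suc p) zero    f≗g = refl
down-cong (suc p) (suc n) f≗g = down-cong p n f≗g

down-∑ℚ : ∀ p n (xs : List A) (f : A → ℕ → ℚ) →
          down p (λ n → ∑ℚ xs (λ x → f x n)) n ≡ ∑ℚ xs (λ x → down p (f x) n)
down-∑ℚ zero    n       xs f = refl
down-∑ℚ (suc p) zero    xs f = sym (∑ℚ-zero xs)
down-∑ℚ (suc p) (suc n) xs f = down-∑ℚ p n xs f

down-*ˡ : ∀ p n c f → down p (λ n → c ℚ.* f n) n ≡ c ℚ.* down p f n
down-*ˡ zero    n       c f = refl
down-*ˡ (suc p) zero    c f = sym (ℚₚ.*-zeroʳ c)
down-*ˡ (suc p) (suc n) c f = down-*ˡ p n c f

down-+ : ∀ p n f g → down p (λ n → f n ℚ.+ g n) n ≡ down p f n ℚ.+ down p g n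
down-+ zero    n       f g = refl
down-+ (suc p) zero    f g = refl
down-+ (suc p) (suc n) f g = down-+ p n f g

down-zero : ∀ p n → down p (λ _ → 0ℚ) n ≡ 0ℚ
down-zero zero    n       = refl
down-zero (suc p) zero    = refl
down-zero (suc p) (suc n) = down-zero p n

down-< : ∀ {p n} f → n < p → down p f n ≡ 0ℚ
down-< {suc p} {zero}  f _         = refl
down-< {suc p} {suc n} f (s<s n<p) = down-< f n<p

down-down : ∀ p q n f → down p (down q f) n ≡ down (p ℕ.+ q) f n
down-down zero    q n       f = refl
down-down (suc p) q zero    f = refl
down-down (suc p) q (suc n) f = down-down p q n f

down-comm : ∀ p q n f → down p (down q f) n ≡ down q (down p f) n
down-comm p q n f = begin
  down p (down q f) n   ≡⟨ down-down p q n f ⟩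
  down (p ℕ.+ q) f n    ≡⟨ cong (λ r → down r f n) (ℕₚ.+-comm p q) ⟩
  down (q ℕ.+ p) f n    ≡⟨ down-down q p n f ⟨
  down q (down p f) n   ∎
  where open ≡-Reasoning

down-δ : ∀ p m n → down p (δ m) n ≡ δ (p ℕ.+ m) n
down-δ zero    m n       = refl
down-δ (suc p) m zero    = refl
down-δ (suc p) m (suc n) = down-δ p m n

-- Product rule for x d/dx on xᵖ f(x), where x d/dx multiplies xᵖ by p.
ι-*-down : ∀ p n f → ι n ℚ.* down p f n ≡ ι p ℚ.* down p f n ℚ.+ down p (λ n → ι n ℚ.* f n) n
ι-*-down zero    n       f =
  sym (trans (cong (ℚ._+ ι n ℚ.* f n) (ℚₚ.*-zeroˡ (f n))) (ℚₚ.+-identityˡ (ι n ℚ.* f n)))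
ι-*-down (suc p) zero    f = sym (trans (ℚₚ.+-identityʳ _) (ℚₚ.*-zeroʳ (ι (suc p))))
ι-*-down (suc p) (suc n) f = begin
  ι (suc n) ℚ.* d                        ≡⟨ cong (ℚ._* d) (ι-suc n) ⟩
  (1ℚ ℚ.+ ι n) ℚ.* d                     ≡⟨ suc-* (ι n) d ⟩
  d ℚ.+ ι n ℚ.* d                        ≡⟨ cong (d ℚ.+_) (ι-*-down p n f) ⟩
  d ℚ.+ (ι p ℚ.* d ℚ.+ e)                ≡⟨ ℚₚ.+-assoc d (ι p ℚ.* d) e ⟨
  d ℚ.+ ι p ℚ.* d ℚ.+ e                  ≡⟨ cong (ℚ._+ e) (suc-* (ι p) d) ⟨
  (1ℚ ℚ.+ ι p) ℚ.* d ℚ.+ e               ≡⟨ cong (λ c → c ℚ.* d ℚ.+ e) (ι-suc p) ⟨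
  ι (suc p) ℚ.* d ℚ.+ e                  ∎
  where
  open ≡-Reasoning
  d = down p f n
  e = down p (λ n → ι n ℚ.* f n) n
  suc-* : ∀ a b → (1ℚ ℚ.+ a) ℚ.* b ≡ b ℚ.+ a ℚ.* b
  suc-* = Q.solve 2 (λ a b → (Q.con 1ℚ Q.:+ a) Q.:* b Q.:= b Q.:+ a Q.:* b) refl

-- Multiplication of a series by t xʲ.
tx : ℕ → Series → Series
tx j F zero    w = 0ℚ
tx j F (suc s) w = down j (F s) w

tx^ : ℕ → ℕ → Series → Series
tx^ j zero    F = F
tx^ j (suc a) F = tx j (tx^ j a F)

-- x d/dx on series.
θ : Series → Series
θ F s w = ι w ℚ.* F s w

-- Equality of series modulo t^(b+1).
infix 4 _≈[_]_
_≈[_]_ : Series → ℕ → Series → Set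
F ≈[ b ] G = ∀ s → s ≤ b → ∀ w → F s w ≡ G s w

tx-cong : ∀ j {b F G} → F ≈[ b ] G → tx j F ≈[ b ] tx j G
tx-cong j F≈G zero    s≤b w = refl
tx-cong j F≈G (suc s) s<b w = down-cong j w (F≈G s (ℕₚ.<⇒≤ s<b))

tx^-cong : ∀ j a {b F G} → F ≈[ b ] G → tx^ j a F ≈[ b ] tx^ j a G
tx^-cong j zero    F≈G = F≈G
tx^-cong j (suc a) F≈G = tx-cong j (tx^-cong j a F≈G)

∑ˢ : List A → (A → Series) → Series
∑ˢ xs F s w = ∑ℚ xs (λ x → F x s w)

infixr 7 _·_
_·_ : ℚ → Series → Series
(c · F) s w = c ℚ.* F s w

module _ (j : ℕ) where

  tx-∑ : ∀ (xs : List A) (F : A → Series) s w → tx j (∑ˢ xs F) s w ≡ ∑ˢ xs (λ x → tx j (F x)) s w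
  tx-∑ xs F zero    w = sym (∑ℚ-zero xs)
  tx-∑ xs F (suc s) w = down-∑ℚ j w xs (λ x → F x s)

  tx-· : ∀ c F s w → tx j (c · F) s w ≡ (c · tx j F) s w
  tx-· c F zero    w = sym (ℚₚ.*-zeroʳ c)
  tx-· c F (suc s) w = down-*ˡ j w c (F s)

  tx-comm : ∀ i F s w → tx i (tx j F) s w ≡ tx j (tx i F) s w
  tx-comm i F zero          w = refl
  tx-comm i F (suc zero)    w = trans (down-zero i w) (sym (down-zero j w))
  tx-comm i F (suc (suc s)) w = down-comm i j w (F s)

  θ-tx : ∀ F s w → θ (tx j F) s w ≡ ι j ℚ.* tx j F s w ℚ.+ tx j (θ F) s w
  θ-tx F zero    w = trans (ℚₚ.*-zeroʳ (ι w)) (sym (trans (ℚₚ.+-identityʳ _) (ℚₚ.*-zeroʳ (ι j))))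
  θ-tx F (suc s) w = ι-*-down j w (F s)

  tx^-∑ : ∀ a (xs : List A) (F : A → Series) s w → tx^ j a (∑ˢ xs F) s w ≡ ∑ˢ xs (λ x → tx^ j a (F x)) s w
  tx^-∑ zero    xs F s w = refl
  tx^-∑ (suc a) xs F s w =
    trans (tx-cong j (λ s _ w → tx^-∑ a xs F s w) s ℕₚ.≤-refl w) (tx-∑ xs (λ x → tx^ j a (F x)) s w)

  tx^-· : ∀ a c F s w → tx^ j a (c · F) s w ≡ (c · tx^ j a F) s w
  tx^-· zero    c F s w = refl
  tx^-· (suc a) c F s w =
    trans (tx-cong j (λ s _ w → tx^-· a c F s w) s ℕₚ.≤-refl w) (tx-· c (tx^ j a F) s w)

  tx^-tx : ∀ a i F s w → tx^ j a (tx i F) s w ≡ tx i (tx^ j a F) s w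
  tx^-tx zero    i F s w = refl
  tx^-tx (suc a) i F s w =
    trans (tx-cong j (λ s _ w → tx^-tx a i F s w) s ℕₚ.≤-refl w) (sym (tx-comm i (tx^ j a F) s w))

  -- Product rule: (t xʲ)ᵃ is an eigenvector of x d/dx with eigenvalue a j.
  θ-tx^ : ∀ a F s w → θ (tx^ j a F) s w ≡ ι a ℚ.* ι j ℚ.* tx^ j a F s w ℚ.+ tx^ j a (θ F) s w
  θ-tx^ zero    F s w = sym (trans (cong (ℚ._+ θ F s w) (trans (cong (ℚ._* F s w) (ℚₚ.*-zeroˡ (ι j))) (ℚₚ.*-zeroˡ (F s w))))
                                   (ℚₚ.+-identityˡ (θ F s w)))
  θ-tx^ (suc a) F s w = begin
    θ (tx^ j (suc a) F) s w
      ≡⟨ θ-tx (tx^ j a F) s w ⟩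
    ι j ℚ.* X ℚ.+ tx j (θ (tx^ j a F)) s w
      ≡⟨ cong (ι j ℚ.* X ℚ.+_) (tx-cong j (λ s _ w → θ-tx^ a F s w) s ℕₚ.≤-refl w) ⟩
    ι j ℚ.* X ℚ.+ tx j (λ s w → ι a ℚ.* ι j ℚ.* tx^ j a F s w ℚ.+ tx^ j a (θ F) s w) s w
      ≡⟨ cong (ι j ℚ.* X ℚ.+_) (tx-+ s) ⟩
    ι j ℚ.* X ℚ.+ (tx j ((ι a ℚ.* ι j) · tx^ j a F) s w ℚ.+ Y)
      ≡⟨ cong (λ z → ι j ℚ.* X ℚ.+ (z ℚ.+ Y)) (tx-· (ι a ℚ.* ι j) (tx^ j a F) s w) ⟩
    ι j ℚ.* X ℚ.+ (ι a ℚ.* ι j ℚ.* X ℚ.+ Y)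
      ≡⟨ Q.solve 4 (λ a j x y → j Q.:* x Q.:+ (a Q.:* j Q.:* x Q.:+ y) Q.:= (Q.con 1ℚ Q.:+ a) Q.:* j Q.:* x Q.:+ y)
           refl (ι a) (ι j) X Y ⟩
    (1ℚ ℚ.+ ι a) ℚ.* ι j ℚ.* X ℚ.+ Y
      ≡⟨ cong (λ c → c ℚ.* ι j ℚ.* X ℚ.+ Y) (ι-suc a) ⟨
    ι (suc a) ℚ.* ι j ℚ.* X ℚ.+ Y ∎
    where
    open ≡-Reasoning
    X = tx^ j (suc a) F s w
    Y = tx^ j (suc a) (θ F) s w
    tx-+ : ∀ {F G} s {w} → tx j (λ s w → F s w ℚ.+ G s w) s w ≡ tx j F s w ℚ.+ tx j G s w
    tx-+ zero        = refl
    tx-+ {F} {G} (suc s) {w} = down-+ j w (F s) (G s)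

  -- (t xʲ)ᵃ F is divisible by tᵃ, which is what makes the truncation in t harmless.
  tx^-< : ∀ {a s} F w → s < a → tx^ j a F s w ≡ 0ℚ
  tx^-< {suc a} {zero}  F w _         = refl
  tx^-< {suc a} {suc s} F w (s<s s<a) =
    trans (down-cong j w (λ w → tx^-< F w s<a)) (down-zero j w)

monomialˢ : ℕ → ℕ → Series
monomialˢ S W s w = δ S s ℚ.* δ W w

-- The new exponents have the shape of the cons clauses of `Vec.sum` and `weight`, so prepending an
-- entry a to a tuple is multiplication by (t xʲ)ᵃ.
tx^-monomial : ∀ j a S W s w → tx^ j a (monomialˢ S W) s w ≡ monomialˢ (a ℕ.+ S) (j ℕ.* a ℕ.+ W) s w
tx^-monomial j zero    S W s w = cong (λ z → monomialˢ S (z ℕ.+ W) s w) (sym (ℕₚ.*-zeroʳ j))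
tx^-monomial j (suc a) S W s w = trans (tx-cong j (λ s _ w → tx^-monomial j a S W s w) s ℕₚ.≤-refl w) (step s)
  where
  step : ∀ s → tx j (monomialˢ (a ℕ.+ S) (j ℕ.* a ℕ.+ W)) s w ≡ monomialˢ (suc a ℕ.+ S) (j ℕ.* suc a ℕ.+ W) s w
  step zero    = sym (ℚₚ.*-zeroˡ (δ (j ℕ.* suc a ℕ.+ W) w))
  step (suc s) = begin
    down j (λ w → δ (a ℕ.+ S) s ℚ.* δ (j ℕ.* a ℕ.+ W) w) w   ≡⟨ down-*ˡ j w (δ (a ℕ.+ S) s) (δ (j ℕ.* a ℕ.+ W)) ⟩
    δ (a ℕ.+ S) s ℚ.* down j (δ (j ℕ.* a ℕ.+ W)) w           ≡⟨ cong (δ (a ℕ.+ S) s ℚ.*_) (down-δ j (j ℕ.* a ℕ.+ W) w) ⟩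
    δ (a ℕ.+ S) s ℚ.* δ (j ℕ.+ (j ℕ.* a ℕ.+ W)) w            ≡⟨ cong (λ v → δ (a ℕ.+ S) s ℚ.* δ v w) j-sum ⟩
    δ (a ℕ.+ S) s ℚ.* δ (j ℕ.* suc a ℕ.+ W) w                ∎
    where
    open ≡-Reasoning
    j-sum : j ℕ.+ (j ℕ.* a ℕ.+ W) ≡ j ℕ.* suc a ℕ.+ W
    j-sum = trans (sym (ℕₚ.+-assoc j (j ℕ.* a) W)) (cong (ℕ._+ W) (sym (ℕₚ.*-suc j a)))

-- The coefficients of ∏ exp(t xʲ/j) over i ≤ j < i + n, each exponential being
-- truncated after the term of degree b in t.
cycleSeries : ℕ → ∀ n → ℕ → Series
cycleSeries b n i = ∑ˢ (vectorsUpTo b n) (λ α → recip (denominator i α) · monomialˢ (Vec.sum α) (weight i α))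

-- The coefficient of (t xⁱ)ᵃ in exp(t xⁱ/i).
expCoeff : ℕ → ℕ → ℚ
expCoeff i a = recip (i ℕ.^ a ℕ.* a !)

-- Coefficient form of d/dy exp(y/i) = exp(y/i)/i with y = t xⁱ.
expCoeff-suc : ∀ i a .{{_ : NonZero i}} → expCoeff i (suc a) ℚ.* (ι (suc a) ℚ.* ι i) ≡ expCoeff i a
expCoeff-suc i a = begin
  recip (i ℕ.^ suc a ℕ.* suc a !) ℚ.* (ι (suc a) ℚ.* ι i)
    ≡⟨ cong₂ (λ p q → recip p ℚ.* q) regroup (sym (ι-* (suc a) i)) ⟩
  recip (suc a ℕ.* i ℕ.* p) ℚ.* ι (suc a ℕ.* i)
    ≡⟨ cong (ℚ._* ι (suc a ℕ.* i)) (recip-* (suc a ℕ.* i) p) ⟩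
  recip (suc a ℕ.* i) ℚ.* recip p ℚ.* ι (suc a ℕ.* i)
    ≡⟨ Q.solve 3 (λ u v w → u Q.:* v Q.:* w Q.:= w Q.:* u Q.:* v) refl (recip (suc a ℕ.* i)) (recip p) (ι (suc a ℕ.* i)) ⟩
  ι (suc a ℕ.* i) ℚ.* recip (suc a ℕ.* i) ℚ.* recip p
    ≡⟨ cong (ℚ._* recip p) (recip-inverse (suc a ℕ.* i)) ⟩
  1ℚ ℚ.* recip p
    ≡⟨ ℚₚ.*-identityˡ (recip p) ⟩
  recip p ∎
  where
  open ≡-Reasoning
  p = i ℕ.^ a ℕ.* a !
  instance
    p≢0 : NonZero p
    p≢0 = ℕₚ.m*n≢0 (i ℕ.^ a) (a !) {{ℕₚ.m^n≢0 i a}} {{a ℕₚ.!≢0}}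
    sa*i≢0 : NonZero (suc a ℕ.* i)
    sa*i≢0 = ℕₚ.m*n≢0 (suc a) i
  regroup : i ℕ.^ suc a ℕ.* suc a ! ≡ suc a ℕ.* i ℕ.* p
  regroup = N.solve 4 (λ i s x y → i N.:* x N.:* (s N.:* y) N.:= s N.:* i N.:* (x N.:* y)) refl i (suc a) (i ℕ.^ a) (a !)

-- The head entry of a tuple ranges over 0, ..., b independently of the tail. The sum therefore
-- factors into the truncated exp(t xⁱ/i) and the series of the tail, whose exponents start at i +
-- 1.
cycleSeries-suc : ∀ b n i .{{_ : NonZero i}} s w →
  cycleSeries b (suc n) i s w ≡ ∑ˢ (upTo (suc b)) (λ a → expCoeff i a · tx^ i a (cycleSeries b n (suc i))) s w
cycleSeries-suc b n i s w = begin
  cycleSeries b (suc n) i s w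
    ≡⟨ ∑ℚ-concatMap (λ a → List.map (a ∷_) (vectorsUpTo b n)) (upTo (suc b)) term ⟩
  ∑ℚ (upTo (suc b)) (λ a → ∑ℚ (List.map (a ∷_) (vectorsUpTo b n)) term)
    ≡⟨ ∑ℚ-cong (upTo (suc b)) per-a ⟩
  ∑ˢ (upTo (suc b)) (λ a → expCoeff i a · tx^ i a (cycleSeries b n (suc i))) s w ∎
  where
  open ≡-Reasoning
  term : ∀ {n} → Vec ℕ n → ℚ
  term α = recip (denominator i α) ℚ.* monomialˢ (Vec.sum α) (weight i α) s w
  summand : ∀ {n} → Vec ℕ n → Series
  summand α = recip (denominator (suc i) α) · monomialˢ (Vec.sum α) (weight (suc i) α)
  per-α : ∀ a (α : Vec ℕ n) → term (a ∷ α) ≡ expCoeff i a ℚ.* tx^ i a (summand α) s w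
  per-α a α = begin
    recip (p ℕ.* q) ℚ.* m
      ≡⟨ cong (ℚ._* m) (recip-* p q {{ℕₚ.m*n≢0 (i ℕ.^ a) (a !) {{ℕₚ.m^n≢0 i a}} {{a ℕₚ.!≢0}}}} {{denominator≢0 (suc i) α}}) ⟩
    recip p ℚ.* recip q ℚ.* m
      ≡⟨ ℚₚ.*-assoc (recip p) (recip q) m ⟩
    recip p ℚ.* (recip q ℚ.* m)
      ≡⟨ cong (λ z → recip p ℚ.* (recip q ℚ.* z)) (tx^-monomial i a (Vec.sum α) (weight (suc i) α) s w) ⟨
    recip p ℚ.* (recip q ℚ.* tx^ i a (monomialˢ (Vec.sum α) (weight (suc i) α)) s w)
      ≡⟨ cong (recip p ℚ.*_) (tx^-· i a (recip q) (monomialˢ (Vec.sum α) (weight (suc i) α)) s w) ⟨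
    recip p ℚ.* tx^ i a (summand α) s w ∎
    where
    p = i ℕ.^ a ℕ.* a !
    q = denominator (suc i) α
    m = monomialˢ (a ℕ.+ Vec.sum α) (i ℕ.* a ℕ.+ weight (suc i) α) s w
  per-a : ∀ a → ∑ℚ (List.map (a ∷_) (vectorsUpTo b n)) term ≡ expCoeff i a ℚ.* tx^ i a (cycleSeries b n (suc i)) s w
  per-a a = begin
    ∑ℚ (List.map (a ∷_) (vectorsUpTo b n)) term
      ≡⟨ ∑ℚ-map (a ∷_) (vectorsUpTo b n) term ⟩
    ∑ℚ (vectorsUpTo b n) (λ α → term (a ∷ α))
      ≡⟨ ∑ℚ-cong (vectorsUpTo b n) (per-α a) ⟩
    ∑ℚ (vectorsUpTo b n) (λ α → expCoeff i a ℚ.* tx^ i a (summand α) s w)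
      ≡⟨ ∑ℚ-*ˡ (vectorsUpTo b n) (expCoeff i a) (λ α → tx^ i a (summand α) s w) ⟩
    expCoeff i a ℚ.* ∑ˢ (vectorsUpTo b n) (λ α → tx^ i a (summand α)) s w
      ≡⟨ cong (expCoeff i a ℚ.*_) (tx^-∑ i a (vectorsUpTo b n) summand s w) ⟨
    expCoeff i a ℚ.* tx^ i a (cycleSeries b n (suc i)) s w ∎

-- θ F = F · ∑ⱼ t xʲ for F = ∏ⱼ exp(t xʲ/j).
θ-cycleSeries : ∀ b n i .{{_ : NonZero i}} →
  θ (cycleSeries b n i) ≈[ b ] ∑ˢ (upTo n) (λ j → tx (i ℕ.+ j) (cycleSeries b n i))
θ-cycleSeries b zero i s s≤b w = trans (cong (ι w ℚ.*_) (trans (ℚₚ.+-identityʳ _) (ℚₚ.*-identityˡ _))) (vanish w)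
  where
  vanish : ∀ w → ι w ℚ.* (δ 0 s ℚ.* δ 0 w) ≡ 0ℚ
  vanish zero    = ℚₚ.*-zeroˡ (δ 0 s ℚ.* δ 0 0)
  vanish (suc w) = trans (cong (ι (suc w) ℚ.*_) (ℚₚ.*-zeroʳ (δ 0 s))) (ℚₚ.*-zeroʳ (ι (suc w)))
θ-cycleSeries b (suc n) i s s≤b w = begin
  ι w ℚ.* X s w
    ≡⟨ cong (ι w ℚ.*_) (X-expand s w) ⟩
  ι w ℚ.* ∑ˢ as (λ a → e a · tx^ i a Y) s w
    ≡⟨ ∑ℚ-*ˡ as (ι w) (λ a → e a ℚ.* tx^ i a Y s w) ⟨
  ∑ℚ as (λ a → ι w ℚ.* (e a ℚ.* tx^ i a Y s w))
    -- `θ` is a derivation: `u` is its effect on the power of t xⁱ, `v` its effect on the remaining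
    -- factors.
    ≡⟨ ∑ℚ-cong as per-a ⟩
  ∑ℚ as (λ a → u a ℚ.+ v a)
    ≡⟨ ∑ℚ-+ as u v ⟩
  ∑ℚ as u ℚ.+ ∑ℚ as v
    ≡⟨ cong₂ ℚ._+_ first rest ⟩
  tx (i ℕ.+ 0) X s w ℚ.+ ∑ℚ (upTo n) (λ j → tx (i ℕ.+ suc j) X s w)
    ≡⟨ ∑ℚ-upTo-first n (λ j → tx (i ℕ.+ j) X s w) ⟨
  ∑ˢ (upTo (suc n)) (λ j → tx (i ℕ.+ j) X) s w ∎
  where
  open ≡-Reasoning
  as = upTo (suc b)
  X  = cycleSeries b (suc n) i
  Y  = cycleSeries b n (suc i)
  e  = expCoeff i
  X-expand = cycleSeries-suc b n i
  u v : ℕ → ℚ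
  u a = e a ℚ.* (ι a ℚ.* ι i) ℚ.* tx^ i a Y s w
  v a = ∑ℚ (upTo n) (λ j → e a ℚ.* tx (i ℕ.+ suc j) (tx^ i a Y) s w)

  tx-X : ∀ j → tx j X s w ≡ ∑ℚ as (λ a → e a ℚ.* tx j (tx^ i a Y) s w)
  tx-X j = begin
    tx j X s w
      ≡⟨ tx-cong j (λ s _ w → X-expand s w) s ℕₚ.≤-refl w ⟩
    tx j (∑ˢ as (λ a → e a · tx^ i a Y)) s w
      ≡⟨ tx-∑ j as (λ a → e a · tx^ i a Y) s w ⟩
    ∑ℚ as (λ a → tx j (e a · tx^ i a Y) s w)
      ≡⟨ ∑ℚ-cong as (λ a → tx-· j (e a) (tx^ i a Y) s w) ⟩
    ∑ℚ as (λ a → e a ℚ.* tx j (tx^ i a Y) s w) ∎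

  tx^-θ : ∀ a → tx^ i a (θ Y) s w ≡ ∑ℚ (upTo n) (λ j → tx (i ℕ.+ suc j) (tx^ i a Y) s w)
  tx^-θ a = begin
    tx^ i a (θ Y) s w
      -- Induction on the number of factors. The hypothesis holds only modulo t^(b+1), and
      -- multiplication by t xⁱ preserves that congruence.
      ≡⟨ tx^-cong i a (θ-cycleSeries b n (suc i)) s s≤b w ⟩
    tx^ i a (∑ˢ (upTo n) (λ j → tx (suc i ℕ.+ j) Y)) s w
      ≡⟨ tx^-∑ i a (upTo n) (λ j → tx (suc i ℕ.+ j) Y) s w ⟩
    ∑ℚ (upTo n) (λ j → tx^ i a (tx (suc i ℕ.+ j) Y) s w)
      ≡⟨ ∑ℚ-cong (upTo n) (λ j → trans (tx^-tx i a (suc i ℕ.+ j) Y s w)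
                                       (cong (λ k → tx k (tx^ i a Y) s w) (sym (ℕₚ.+-suc i j)))) ⟩
    ∑ℚ (upTo n) (λ j → tx (i ℕ.+ suc j) (tx^ i a Y) s w) ∎

  per-a : ∀ a → ι w ℚ.* (e a ℚ.* tx^ i a Y s w) ≡ u a ℚ.+ v a
  per-a a = begin
    ι w ℚ.* (e a ℚ.* tx^ i a Y s w)
      ≡⟨ Q.solve 3 (λ w e y → w Q.:* (e Q.:* y) Q.:= e Q.:* (w Q.:* y)) refl (ι w) (e a) (tx^ i a Y s w) ⟩
    e a ℚ.* θ (tx^ i a Y) s w
      ≡⟨ cong (e a ℚ.*_) (θ-tx^ i a Y s w) ⟩
    e a ℚ.* (ι a ℚ.* ι i ℚ.* tx^ i a Y s w ℚ.+ tx^ i a (θ Y) s w)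
      ≡⟨ Q.solve 4 (λ e c y z → e Q.:* (c Q.:* y Q.:+ z) Q.:= e Q.:* c Q.:* y Q.:+ e Q.:* z) refl
           (e a) (ι a ℚ.* ι i) (tx^ i a Y s w) (tx^ i a (θ Y) s w) ⟩
    u a ℚ.+ e a ℚ.* tx^ i a (θ Y) s w
      ≡⟨ cong (λ z → u a ℚ.+ e a ℚ.* z) (tx^-θ a) ⟩
    u a ℚ.+ e a ℚ.* ∑ℚ (upTo n) (λ j → tx (i ℕ.+ suc j) (tx^ i a Y) s w)
      ≡⟨ cong (u a ℚ.+_) (∑ℚ-*ˡ (upTo n) (e a) (λ j → tx (i ℕ.+ suc j) (tx^ i a Y) s w)) ⟨
    u a ℚ.+ v a ∎

  first : ∑ℚ as u ≡ tx (i ℕ.+ 0) X s w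
  first = begin
    ∑ℚ as u
      ≡⟨ ∑ℚ-upTo-first b u ⟩
    u 0 ℚ.+ ∑ℚ (upTo b) (λ a → u (suc a))
      ≡⟨ cong₂ ℚ._+_ u-zero (∑ℚ-cong (upTo b) (λ a → cong (ℚ._* tx^ i (suc a) Y s w) (expCoeff-suc i a))) ⟩
    0ℚ ℚ.+ ∑ℚ (upTo b) (λ a → e a ℚ.* tx^ i (suc a) Y s w)
      ≡⟨ ℚₚ.+-comm 0ℚ (∑ℚ (upTo b) (λ a → e a ℚ.* tx^ i (suc a) Y s w)) ⟩
    ∑ℚ (upTo b) (λ a → e a ℚ.* tx^ i (suc a) Y s w) ℚ.+ 0ℚ
      -- The summand a = b is added to complete the truncated exponential again. It is divisible by
      -- t^(b+1), so it vanishes at degree s ≤ b.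
      ≡⟨ cong (∑ℚ (upTo b) (λ a → e a ℚ.* tx^ i (suc a) Y s w) ℚ.+_) last-zero ⟨
    ∑ℚ (upTo b) (λ a → e a ℚ.* tx^ i (suc a) Y s w) ℚ.+ e b ℚ.* tx^ i (suc b) Y s w
      ≡⟨ ∑ℚ-upTo-last b (λ a → e a ℚ.* tx^ i (suc a) Y s w) ⟨
    ∑ℚ as (λ a → e a ℚ.* tx i (tx^ i a Y) s w)
      ≡⟨ tx-X i ⟨
    tx i X s w
      ≡⟨ cong (λ j → tx j X s w) (ℕₚ.+-identityʳ i) ⟨
    tx (i ℕ.+ 0) X s w ∎
    where
    u-zero : u 0 ≡ 0ℚ
    u-zero = Q.solve 3 (λ e i y → e Q.:* (Q.con 0ℚ Q.:* i) Q.:* y Q.:= Q.con 0ℚ) refl (e 0) (ι i) (Y s w)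
    last-zero : e b ℚ.* tx^ i (suc b) Y s w ≡ 0ℚ
    last-zero = trans (cong (e b ℚ.*_) (tx^-< i Y w (s≤s s≤b))) (ℚₚ.*-zeroʳ (e b))

  rest : ∑ℚ as v ≡ ∑ℚ (upTo n) (λ j → tx (i ℕ.+ suc j) X s w)
  rest = begin
    ∑ℚ as v
      ≡⟨ ∑ℚ-swap as (upTo n) (λ a j → e a ℚ.* tx (i ℕ.+ suc j) (tx^ i a Y) s w) ⟩
    ∑ℚ (upTo n) (λ j → ∑ℚ as (λ a → e a ℚ.* tx (i ℕ.+ suc j) (tx^ i a Y) s w))
      ≡⟨ ∑ℚ-cong (upTo n) (λ j → sym (tx-X (i ℕ.+ suc j))) ⟩
    ∑ℚ (upTo n) (λ j → tx (i ℕ.+ suc j) X s w) ∎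

-- At x = 0 every exponential is 1, because all exponents of x are positive.
cycleSeries-0 : ∀ b n i .{{_ : NonZero i}} s → cycleSeries b n i s 0 ≡ δ 0 s
cycleSeries-0 b zero    i s = trans (ℚₚ.+-identityʳ _) (trans (ℚₚ.*-identityˡ _) (ℚₚ.*-identityʳ (δ 0 s)))
cycleSeries-0 b (suc n) i s = begin
  cycleSeries b (suc n) i s 0
    ≡⟨ cycleSeries-suc b n i s 0 ⟩
  ∑ℚ (upTo (suc b)) (λ a → expCoeff i a ℚ.* tx^ i a Y s 0)
    ≡⟨ ∑ℚ-upTo-first b (λ a → expCoeff i a ℚ.* tx^ i a Y s 0) ⟩
  1ℚ ℚ.* Y s 0 ℚ.+ ∑ℚ (upTo b) (λ a → expCoeff i (suc a) ℚ.* tx^ i (suc a) Y s 0)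
    ≡⟨ cong₂ ℚ._+_ (trans (ℚₚ.*-identityˡ (Y s 0)) (cycleSeries-0 b n (suc i) s))
         (trans (∑ℚ-cong (upTo b) (λ a → trans (cong (expCoeff i (suc a) ℚ.*_) (tx-0 i (tx^ i a Y) s))
                                                  (ℚₚ.*-zeroʳ (expCoeff i (suc a)))))
                (∑ℚ-zero (upTo b))) ⟩
  δ 0 s ℚ.+ 0ℚ
    ≡⟨ ℚₚ.+-identityʳ (δ 0 s) ⟩
  δ 0 s ∎
  where
  open ≡-Reasoning
  Y = cycleSeries b n (suc i)
  tx-0 : ∀ j .{{_ : NonZero j}} F s → tx j F s 0 ≡ 0ℚ
  tx-0 (suc j) F zero    = refl
  tx-0 (suc j) F (suc s) = refl

-- (1 - x) ∑_{j=1}^{n} t xʲ = t x - t xⁿ⁺¹.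
cycleSeries-recurrence : ∀ b n s w → s ≤ b → w < n →
  ι (suc w) ℚ.* cycleSeries b n 1 s (suc w) ≡ ι w ℚ.* cycleSeries b n 1 s w ℚ.+ tx 0 (cycleSeries b n 1) s w
cycleSeries-recurrence b n@(suc m) s w s≤b (s≤s w≤m) = begin
  ι (suc w) ℚ.* X s (suc w)
    ≡⟨ θ-cycleSeries b n 1 s s≤b (suc w) ⟩
  ∑ℚ (upTo n) (λ j → tx (suc j) X s (suc w))
    -- The sum at x^(w+1) is the sum at xʷ with its index shifted down by one, so the two differ
    -- only in their end terms.
    ≡⟨ ∑ℚ-cong (upTo n) (λ j → tx-suc-suc j s) ⟩
  ∑ℚ (upTo n) (λ j → tx j X s w)
    ≡⟨ ∑ℚ-upTo-first m (λ j → tx j X s w) ⟩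
  tx 0 X s w ℚ.+ ∑ℚ (upTo m) (λ j → tx (suc j) X s w)
    ≡⟨ ℚₚ.+-comm (tx 0 X s w) Z ⟩
  Z ℚ.+ tx 0 X s w
    -- The end term t x^(m+1) can be inserted freely: it has no coefficient at xʷ since w ≤ m.
    ≡⟨ cong (ℚ._+ tx 0 X s w) (trans (cong (Z ℚ.+_) (tx-high s)) (ℚₚ.+-identityʳ Z)) ⟨
  Z ℚ.+ tx (suc m) X s w ℚ.+ tx 0 X s w
    ≡⟨ cong (ℚ._+ tx 0 X s w) (∑ℚ-upTo-last m (λ j → tx (suc j) X s w)) ⟨
  ∑ℚ (upTo n) (λ j → tx (suc j) X s w) ℚ.+ tx 0 X s w
    ≡⟨ cong (ℚ._+ tx 0 X s w) (θ-cycleSeries b n 1 s s≤b w) ⟨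
  ι w ℚ.* X s w ℚ.+ tx 0 X s w ∎
  where
  open ≡-Reasoning
  X = cycleSeries b n 1
  Z = ∑ℚ (upTo m) (λ j → tx (suc j) X s w)
  tx-suc-suc : ∀ j s → tx (suc j) X s (suc w) ≡ tx j X s w
  tx-suc-suc j zero    = refl
  tx-suc-suc j (suc s) = refl
  tx-high : ∀ s → tx (suc m) X s w ≡ 0ℚ
  tx-high zero    = refl
  tx-high (suc s) = down-< (X s) (s≤s w≤m)

-- Unsigned Stirling numbers of the first kind.
stirling : ℕ → ℕ → ℚ
stirling zero    s = δ 0 s
stirling (suc k) s = ι k ℚ.* stirling k s ℚ.+ down 1 (stirling k) s

-- The recurrence scaled by w!. All s ≤ b are treated at once because the second summand refers to s
-- - 1, and w ≤ n keeps the recurrence valid.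
stirling-cycleSeries : ∀ b n w → w ≤ n → ∀ s → s ≤ b → ι (w !) ℚ.* cycleSeries b n 1 s w ≡ stirling w s
stirling-cycleSeries b n zero    _   s s≤b = trans (ℚₚ.*-identityˡ _) (cycleSeries-0 b n 1 s)
stirling-cycleSeries b n (suc w) w<n s s≤b = begin
  ι (suc w ℕ.* w !) ℚ.* X s (suc w)
    ≡⟨ cong (ℚ._* X s (suc w)) (ι-* (suc w) (w !)) ⟩
  ι (suc w) ℚ.* c ℚ.* X s (suc w)
    ≡⟨ Q.solve 3 (λ w c x → w Q.:* c Q.:* x Q.:= c Q.:* (w Q.:* x)) refl (ι (suc w)) c (X s (suc w)) ⟩
  c ℚ.* (ι (suc w) ℚ.* X s (suc w))
    ≡⟨ cong (c ℚ.*_) (cycleSeries-recurrence b n s w s≤b w<n) ⟩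
  c ℚ.* (ι w ℚ.* X s w ℚ.+ tx 0 X s w)
    ≡⟨ Q.solve 4 (λ w c x y → c Q.:* (w Q.:* x Q.:+ y) Q.:= w Q.:* (c Q.:* x) Q.:+ c Q.:* y) refl (ι w) c (X s w) (tx 0 X s w) ⟩
  ι w ℚ.* (c ℚ.* X s w) ℚ.+ c ℚ.* tx 0 X s w
    ≡⟨ cong₂ (λ p q → ι w ℚ.* p ℚ.+ q) (IH s s≤b) (lower s s≤b) ⟩
  stirling (suc w) s ∎
  where
  open ≡-Reasoning
  X = cycleSeries b n 1
  c = ι (w !)
  IH = stirling-cycleSeries b n w (ℕₚ.<⇒≤ w<n)
  lower : ∀ s → s ≤ b → c ℚ.* tx 0 X s w ≡ down 1 (stirling w) s
  lower zero    _   = ℚₚ.*-zeroʳ c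
  lower (suc s) s<b = IH s (ℕₚ.<⇒≤ s<b)

∑-cycleTerm : ∀ k s → ∑ℚ (tuples s k) (cycleTerm k) ≡ stirling k s
∑-cycleTerm k s = begin
  ∑ℚ (tuples s k) (cycleTerm k)
    ≡⟨ ∑ℚ-filter (λ α → (Vec.sum α ℕₚ.≟ s) ×-dec (weight 1 α ℕₚ.≟ k)) (vectorsUpTo s k) (cycleTerm k) ⟩
  ∑ℚ (vectorsUpTo s k) (λ α → cycleTerm k α ℚ.* (if does ((Vec.sum α ℕₚ.≟ s) ×-dec (weight 1 α ℕₚ.≟ k)) then 1ℚ else 0ℚ))
    ≡⟨ ∑ℚ-cong (vectorsUpTo s k) (λ α → trans
         (cong₂ ℚ._*_ (/≡*-recip (k !) (denominator 1 α) {{denominator≢0 1 α}}) (δ-does (Vec.sum α) s (weight 1 α) k))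
         (ℚₚ.*-assoc (ι (k !)) (recip (denominator 1 α)) _)) ⟩
  ∑ℚ (vectorsUpTo s k) (λ α → ι (k !) ℚ.* (recip (denominator 1 α) · monomialˢ (Vec.sum α) (weight 1 α)) s k)
    ≡⟨ ∑ℚ-*ˡ (vectorsUpTo s k) (ι (k !)) (λ α → (recip (denominator 1 α) · monomialˢ (Vec.sum α) (weight 1 α)) s k) ⟩
  ι (k !) ℚ.* cycleSeries s k 1 s k
    -- Entries bounded by s give the truncation degree b = s, and the k factors reach exactly xᵏ.
    ≡⟨ stirling-cycleSeries s k k ℕₚ.≤-refl s ℕₚ.≤-refl ⟩
  stirling k s ∎
  where open ≡-Reasoning

-- Eventual properties and rational inequalities

Eventually : (ℕ → Set) → Set
Eventually P = ∃[ N ] (∀ n → N ≤ n → P n)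

always : ∀ {P : ℕ → Set} → (∀ n → P n) → Eventually P
always p = 0 , λ n _ → p n

eventually₂ : ∀ {P P′ R : ℕ → Set} → (∀ n → P n → P′ n → R n) → Eventually P → Eventually P′ → Eventually R
eventually₂ f (M , p) (N , p′) = M ℕ.⊔ N , λ n M⊔N≤n →
  f n (p n (ℕₚ.m⊔n≤o⇒m≤o M N M⊔N≤n)) (p′ n (ℕₚ.m⊔n≤o⇒n≤o M N M⊔N≤n))

0≤-+ : ∀ {p q} → 0ℚ ℚ.≤ p → 0ℚ ℚ.≤ q → 0ℚ ℚ.≤ p ℚ.+ q
0≤-+ 0≤p 0≤q = ℚₚ.+-mono-≤ 0≤p 0≤q

0≤-* : ∀ {p q} → 0ℚ ℚ.≤ p → 0ℚ ℚ.≤ q → 0ℚ ℚ.≤ p ℚ.* q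
0≤-* {p} {q} 0≤p 0≤q =
  ℚₚ.nonNegative⁻¹ (p ℚ.* q) {{ℚₚ.nonNeg*nonNeg⇒nonNeg p {{ℚ.nonNegative 0≤p}} q {{ℚ.nonNegative 0≤q}}}}

0≤p² : ∀ p → 0ℚ ℚ.≤ p ℚ.* p
0≤p² p with ℚₚ.≤-total 0ℚ p
... | inj₁ 0≤p = 0≤-* 0≤p 0≤p
... | inj₂ p≤0 = subst (0ℚ ℚ.≤_) (Q.solve 1 (λ p → (Q.:- p) Q.:* (Q.:- p) Q.:= p Q.:* p) refl p)
                   (0≤-* (ℚₚ.neg-antimono-≤ p≤0) (ℚₚ.neg-antimono-≤ p≤0))

-- Lets an inequality be proved by writing the difference as a visibly nonnegative expression.
≤-+ʳ : ∀ {p q r} → 0ℚ ℚ.≤ r → q ≡ p ℚ.+ r → p ℚ.≤ q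
≤-+ʳ {p} 0≤r q≡p+r = subst₂ ℚ._≤_ (ℚₚ.+-identityʳ p) (sym q≡p+r) (ℚₚ.+-monoʳ-≤ p 0≤r)

*-mono-0≤ : ∀ {a b c d} → 0ℚ ℚ.≤ a → a ℚ.≤ c → 0ℚ ℚ.≤ b → b ℚ.≤ d → a ℚ.* b ℚ.≤ c ℚ.* d
*-mono-0≤ {a} {b} {c} {d} 0≤a a≤c 0≤b b≤d = subst (ℚ._≤ c ℚ.* d) (ℚₚ.0≤p⇒∣p∣≡p (0≤-* 0≤a 0≤b))
  (*-mono-abs {a} {b} (subst (ℚ._≤ c) (sym (ℚₚ.0≤p⇒∣p∣≡p 0≤a)) a≤c) (subst (ℚ._≤ d) (sym (ℚₚ.0≤p⇒∣p∣≡p 0≤b)) b≤d))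

∣p∣≤⇒p²≤ : ∀ {p b} → ℚ.∣ p ∣ ℚ.≤ b → p ℚ.* p ℚ.≤ b ℚ.* b
∣p∣≤⇒p²≤ {p} {b} ∣p∣≤b = subst (ℚ._≤ b ℚ.* b) (ℚₚ.0≤p⇒∣p∣≡p (0≤p² p)) (*-mono-abs {p} {p} ∣p∣≤b ∣p∣≤b)

-- ℝ and ℂ as setoids with ring operations

∣sum∣≤ : ∀ {p q r ε} → r ≡ p ℚ.+ q → ℚ.∣ p ∣ ℚ.≤ ε ℚ.* ℚ.½ → ℚ.∣ q ∣ ℚ.≤ ε ℚ.* ℚ.½ → ℚ.∣ r ∣ ℚ.≤ ε
∣sum∣≤ {p} {q} {r} {ε} refl p≤ q≤ = begin
  ℚ.∣ p ℚ.+ q ∣               ≤⟨ ℚₚ.∣p+q∣≤∣p∣+∣q∣ p q ⟩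
  ℚ.∣ p ∣ ℚ.+ ℚ.∣ q ∣         ≤⟨ ℚₚ.+-mono-≤ p≤ q≤ ⟩
  ε ℚ.* ℚ.½ ℚ.+ ε ℚ.* ℚ.½     ≡⟨ halves ε ⟩
  ε                           ∎
  where open ℚₚ.≤-Reasoning

≈ᴿ-pointwise : ∀ {x y} → (∀ n → seq x n ≡ seq y n) → x ≈ᴿ y
≈ᴿ-pointwise {x} {y} x≗y ε 0<ε = always λ n → subst (λ q → ℚ.∣ q ∣ ℚ.≤ ε)
  (trans (sym (ℚₚ.+-inverseʳ (seq y n))) (cong (ℚ._- seq y n) (sym (x≗y n)))) (ℚₚ.<⇒≤ 0<ε)

≈ᴿ-sym : ∀ {x y} → x ≈ᴿ y → y ≈ᴿ x
≈ᴿ-sym {x} {y} x≈y ε 0<ε = map₂ (λ h n N≤n → subst (ℚ._≤ ε)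
  (trans (sym (ℚₚ.∣-p∣≡∣p∣ (seq x n ℚ.- seq y n)))
         (cong ℚ.∣_∣ (Q.solve 2 (λ a b → Q.:- (a Q.:- b) Q.:= b Q.:- a) refl (seq x n) (seq y n))))
  (h n N≤n)) (x≈y ε 0<ε)

≈ᴿ-trans : ∀ {x y z} → x ≈ᴿ y → y ≈ᴿ z → x ≈ᴿ z
≈ᴿ-trans {x} {y} {z} x≈y y≈z ε 0<ε =
  eventually₂ (λ n → ∣sum∣≤ (Q.solve 3 (λ a b c → a Q.:- c Q.:= (a Q.:- b) Q.:+ (b Q.:- c)) refl (seq x n) (seq y n) (seq z n)))
    (x≈y (ε ℚ.* ℚ.½) (half-pos 0<ε)) (y≈z (ε ℚ.* ℚ.½) (half-pos 0<ε))

+ᴿ-cong : ∀ {x x′ y y′} → x ≈ᴿ x′ → y ≈ᴿ y′ → x +ᴿ y ≈ᴿ x′ +ᴿ y′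
+ᴿ-cong {x} {x′} {y} {y′} x≈x′ y≈y′ ε 0<ε =
  eventually₂ (λ n → ∣sum∣≤ (Q.solve 4 (λ a b c d → (a Q.:+ b) Q.:- (c Q.:+ d) Q.:= (a Q.:- c) Q.:+ (b Q.:- d)) refl
                              (seq x n) (seq y n) (seq x′ n) (seq y′ n)))
    (x≈x′ (ε ℚ.* ℚ.½) (half-pos 0<ε)) (y≈y′ (ε ℚ.* ℚ.½) (half-pos 0<ε))

-ᴿ-cong : ∀ {x x′} → x ≈ᴿ x′ → -ᴿ x ≈ᴿ -ᴿ x′
-ᴿ-cong {x} {x′} x≈x′ ε 0<ε = map₂ (λ h n N≤n → subst (ℚ._≤ ε)
  (trans (sym (ℚₚ.∣-p∣≡∣p∣ (seq x n ℚ.- seq x′ n))) (cong ℚ.∣_∣ (ℚₚ.neg-distrib-+ (seq x n) (ℚ.- seq x′ n))))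
  (h n N≤n)) (x≈x′ ε 0<ε)

-- From x y - x′ y′ = x (y - y′) + (x - x′) y′: eventual bounds B on x and C on y′ permit δ = ε/(B +
-- C).
*ᴿ-cong : ∀ {x x′ y y′} → x ≈ᴿ x′ → y ≈ᴿ y′ → x *ᴿ y ≈ᴿ x′ *ᴿ y′
*ᴿ-cong {x} {x′} {y} {y′} x≈x′ y≈y′ ε 0<ε =
  let B , 0<B , x≤B  = cauchy-bound {seq x} (cauchy x)
      C , 0<C , y′≤C = cauchy-bound {seq y′} (cauchy y′)
      δ , 0<δ , ε≡   = split-ε {B ℚ.+ C} {ε} (ℚₚ.+-mono-< {0ℚ} {B} {0ℚ} {C} 0<B 0<C) 0<ε
  in eventually₂
       (λ n (xB , yC) (dx , dy) → subst (ℚ.∣ seq x n ℚ.* seq y n ℚ.- seq x′ n ℚ.* seq y′ n ∣ ℚ.≤_)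
         (sym (trans ε≡ (collect B C δ)))
         (product-close {seq x n} {seq y n} {seq x′ n} {seq y′ n} {B} {C} {δ} xB yC dx dy))
       (eventually₂ (λ n → _,_) x≤B y′≤C)
       (eventually₂ (λ n → _,_) (x≈x′ δ 0<δ) (y≈y′ δ 0<δ))

ℚ[i] : Set
ℚ[i] = ℚ × ℚ

-- Since ℂ computes termwise, `sample n` commutes with the ring operations by definition. Ring
-- identities in ℂ thus reduce to identities in ℚ[i], where equality is propositional and a ring
-- solver applies.
sample : ℕ → ℂ → ℚ[i]
sample n z = seq (re z) n , seq (im z) n

≈-pointwise : ∀ {z w} → (∀ n → sample n z ≡ sample n w) → z ≈ w
≈-pointwise {z} {w} z≗w =
  ≈ᴿ-pointwise {re z} {re w} (cong proj₁ ∘ z≗w) , ≈ᴿ-pointwise {im z} {im w} (cong proj₂ ∘ z≗w)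

≈-refl : ∀ {z} → z ≈ z
≈-refl {z} = ≈-pointwise {z} {z} (λ _ → refl)

≈-sym : ∀ {z w} → z ≈ w → w ≈ z
≈-sym {z} {w} (re≈ , im≈) = ≈ᴿ-sym {re z} {re w} re≈ , ≈ᴿ-sym {im z} {im w} im≈

≈-trans : ∀ {z w v} → z ≈ w → w ≈ v → z ≈ v
≈-trans {z} {w} {v} (re≈ , im≈) (re≈′ , im≈′) =
  ≈ᴿ-trans {re z} {re w} {re v} re≈ re≈′ , ≈ᴿ-trans {im z} {im w} {im v} im≈ im≈′

+-cong : ∀ {z z′ w w′} → z ≈ z′ → w ≈ w′ → z + w ≈ z′ + w′
+-cong {z} {z′} {w} {w′} (re≈ , im≈) (re≈′ , im≈′) =
  +ᴿ-cong {re z} {re z′} {re w} {re w′} re≈ re≈′ , +ᴿ-cong {im z} {im z′} {im w} {im w′} im≈ im≈′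

*-cong : ∀ {z z′ w w′} → z ≈ z′ → w ≈ w′ → z * w ≈ z′ * w′
*-cong {z} {z′} {w} {w′} (re≈ , im≈) (re≈′ , im≈′) =
    +ᴿ-cong {a *ᴿ c} {a′ *ᴿ c′} { -ᴿ (b *ᴿ d)} { -ᴿ (b′ *ᴿ d′)}
      (*ᴿ-cong {a} {a′} {c} {c′} re≈ re≈′)
      (-ᴿ-cong {b *ᴿ d} {b′ *ᴿ d′} (*ᴿ-cong {b} {b′} {d} {d′} im≈ im≈′))
  , +ᴿ-cong {a *ᴿ d} {a′ *ᴿ d′} {b *ᴿ c} {b′ *ᴿ c′}
      (*ᴿ-cong {a} {a′} {d} {d′} re≈ im≈′)
      (*ᴿ-cong {b} {b′} {c} {c′} im≈ re≈′)
  where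
  a = re z; b = im z; c = re w; d = im w
  a′ = re z′; b′ = im z′; c′ = re w′; d′ = im w′

-- Gaussian rationals: the values of a complex number's approximating sequences

infixl 6 _⊞_ _⊟_
infixl 7 _⊠_

_⊞_ _⊠_ _⊟_ : ℚ[i] → ℚ[i] → ℚ[i]
neg : ℚ[i] → ℚ[i]
z ⊞ w = proj₁ z ℚ.+ proj₁ w , proj₂ z ℚ.+ proj₂ w
z ⊠ w = proj₁ z ℚ.* proj₁ w ℚ.+ ℚ.- (proj₂ z ℚ.* proj₂ w) , proj₁ z ℚ.* proj₂ w ℚ.+ proj₂ z ℚ.* proj₁ w
neg z = ℚ.- proj₁ z , ℚ.- proj₂ z
z ⊟ w = z ⊞ neg w

∥_∥² : ℚ[i] → ℚ
∥ z ∥² = proj₁ z ℚ.* proj₁ z ℚ.+ proj₂ z ℚ.* proj₂ z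

ℚ[i]-commutativeRing : CommutativeRing 0ℓ 0ℓ
ℚ[i]-commutativeRing = record
  { Carrier = ℚ[i] ; _≈_ = _≡_ ; _+_ = _⊞_ ; _*_ = _⊠_ ; -_ = neg ; 0# = 0ℚ , 0ℚ ; 1# = 1ℚ , 0ℚ
  ; isCommutativeRing = record
    { isRing = record
      { +-isAbelianGroup = record
        { isGroup = record
          { isMonoid = record
            { isSemigroup = record
              { isMagma = record { isEquivalence = isEquivalence ; ∙-cong = cong₂ _⊞_ }
              ; assoc = λ x y z → cong₂ _,_ (ℚₚ.+-assoc (proj₁ x) (proj₁ y) (proj₁ z)) (ℚₚ.+-assoc (proj₂ x) (proj₂ y) (proj₂ z))
              }
            ; identity = (λ x → cong₂ _,_ (ℚₚ.+-identityˡ (proj₁ x)) (ℚₚ.+-identityˡ (proj₂ x)))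
                       , (λ x → cong₂ _,_ (ℚₚ.+-identityʳ (proj₁ x)) (ℚₚ.+-identityʳ (proj₂ x)))
            }
          ; inverse = (λ x → cong₂ _,_ (ℚₚ.+-inverseˡ (proj₁ x)) (ℚₚ.+-inverseˡ (proj₂ x)))
                    , (λ x → cong₂ _,_ (ℚₚ.+-inverseʳ (proj₁ x)) (ℚₚ.+-inverseʳ (proj₂ x)))
          ; ⁻¹-cong = cong neg
          }
        ; comm = λ x y → cong₂ _,_ (ℚₚ.+-comm (proj₁ x) (proj₁ y)) (ℚₚ.+-comm (proj₂ x) (proj₂ y))
        }
      ; *-cong = cong₂ _⊠_
      ; *-assoc = λ (a , b) (c , d) (e , f) → cong₂ _,_
          (Q.solve 6 (λ a b c d e f →
            (a Q.:* c Q.:- b Q.:* d) Q.:* e Q.:- (a Q.:* d Q.:+ b Q.:* c) Q.:* f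
            Q.:= a Q.:* (c Q.:* e Q.:- d Q.:* f) Q.:- b Q.:* (c Q.:* f Q.:+ d Q.:* e)) refl a b c d e f)
          (Q.solve 6 (λ a b c d e f →
            (a Q.:* c Q.:- b Q.:* d) Q.:* f Q.:+ (a Q.:* d Q.:+ b Q.:* c) Q.:* e
            Q.:= a Q.:* (c Q.:* f Q.:+ d Q.:* e) Q.:+ b Q.:* (c Q.:* e Q.:- d Q.:* f)) refl a b c d e f)
      ; *-identity = (λ (a , b) → cong₂ _,_
                       (Q.solve 2 (λ a b → Q.con 1ℚ Q.:* a Q.:- Q.con 0ℚ Q.:* b Q.:= a) refl a b)
                       (Q.solve 2 (λ a b → Q.con 1ℚ Q.:* b Q.:+ Q.con 0ℚ Q.:* a Q.:= b) refl a b))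
                   , (λ (a , b) → cong₂ _,_
                       (Q.solve 2 (λ a b → a Q.:* Q.con 1ℚ Q.:- b Q.:* Q.con 0ℚ Q.:= a) refl a b)
                       (Q.solve 2 (λ a b → a Q.:* Q.con 0ℚ Q.:+ b Q.:* Q.con 1ℚ Q.:= b) refl a b))
      ; distrib = (λ (a , b) (c , d) (e , f) → cong₂ _,_
                    (Q.solve 6 (λ a b c d e f → a Q.:* (c Q.:+ e) Q.:- b Q.:* (d Q.:+ f)
                      Q.:= (a Q.:* c Q.:- b Q.:* d) Q.:+ (a Q.:* e Q.:- b Q.:* f)) refl a b c d e f)
                    (Q.solve 6 (λ a b c d e f → a Q.:* (d Q.:+ f) Q.:+ b Q.:* (c Q.:+ e)
                      Q.:= (a Q.:* d Q.:+ b Q.:* c) Q.:+ (a Q.:* f Q.:+ b Q.:* e)) refl a b c d e f))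
                , (λ (a , b) (c , d) (e , f) → cong₂ _,_
                    (Q.solve 6 (λ a b c d e f → (c Q.:+ e) Q.:* a Q.:- (d Q.:+ f) Q.:* b
                      Q.:= (c Q.:* a Q.:- d Q.:* b) Q.:+ (e Q.:* a Q.:- f Q.:* b)) refl a b c d e f)
                    (Q.solve 6 (λ a b c d e f → (c Q.:+ e) Q.:* b Q.:+ (d Q.:+ f) Q.:* a
                      Q.:= (c Q.:* b Q.:+ d Q.:* a) Q.:+ (e Q.:* b Q.:+ f Q.:* a)) refl a b c d e f))
      }
    ; *-comm = λ (a , b) (c , d) → cong₂ _,_
        (Q.solve 4 (λ a b c d → a Q.:* c Q.:- b Q.:* d Q.:= c Q.:* a Q.:- d Q.:* b) refl a b c d)
        (Q.solve 4 (λ a b c d → a Q.:* d Q.:+ b Q.:* c Q.:= c Q.:* b Q.:+ d Q.:* a) refl a b c d)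
    }
  }

private
  module G = Algebra.Solver.Ring.Simple (ACR.fromCommutativeRing ℚ[i]-commutativeRing)
               (Productₚ.≡-dec ℚₚ._≟_ ℚₚ._≟_)

∥∥²-nonneg : ∀ z → 0ℚ ℚ.≤ ∥ z ∥²
∥∥²-nonneg (a , b) = 0≤-+ (0≤p² a) (0≤p² b)

∥⊠∥² : ∀ z w → ∥ z ⊠ w ∥² ≡ ∥ z ∥² ℚ.* ∥ w ∥²
∥⊠∥² (a , b) (c , d) = Q.solve 4 (λ a b c d →
  (a Q.:* c Q.:- b Q.:* d) Q.:* (a Q.:* c Q.:- b Q.:* d) Q.:+ (a Q.:* d Q.:+ b Q.:* c) Q.:* (a Q.:* d Q.:+ b Q.:* c)
  Q.:= (a Q.:* a Q.:+ b Q.:* b) Q.:* (c Q.:* c Q.:+ d Q.:* d)) refl a b c d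

-- Parallelogram identity.
∥⊞∥²≤ : ∀ z w → ∥ z ⊞ w ∥² ℚ.≤ (∥ z ∥² ℚ.+ ∥ w ∥²) ℚ.+ (∥ z ∥² ℚ.+ ∥ w ∥²)
∥⊞∥²≤ z@(a , b) w@(c , d) = ≤-+ʳ (∥∥²-nonneg (z ⊟ w)) (Q.solve 4 (λ a b c d →
  ((a Q.:* a Q.:+ b Q.:* b) Q.:+ (c Q.:* c Q.:+ d Q.:* d)) Q.:+ ((a Q.:* a Q.:+ b Q.:* b) Q.:+ (c Q.:* c Q.:+ d Q.:* d))
  Q.:= ((a Q.:+ c) Q.:* (a Q.:+ c) Q.:+ (b Q.:+ d) Q.:* (b Q.:+ d))
  Q.:+ ((a Q.:- c) Q.:* (a Q.:- c) Q.:+ (b Q.:- d) Q.:* (b Q.:- d))) refl a b c d)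

-- Polynomials, with their derivatives and values

infixl 6 _⊕_
infixl 7 _⊗_

-- Syntax trees instead of coefficient lists: derivatives, values and remainders all follow the sum
-- and product rules by structural recursion.
data Poly : Set where
  con     : ℚ → Poly
  X       : Poly
  _⊕_ _⊗_ : Poly → Poly → Poly

∂ : Poly → Poly
∂ (con c) = con 0ℚ
∂ X       = con 1ℚ
∂ (p ⊕ q) = ∂ p ⊕ ∂ q
∂ (p ⊗ q) = ∂ p ⊗ q ⊕ p ⊗ ∂ q

eval : Poly → ℂ → ℂ
eval (con c) z = fromℚ c
eval X       z = z
eval (p ⊕ q) z = eval p z + eval q z
eval (p ⊗ q) z = eval p z * eval q z

evalG : Poly → ℚ[i] → ℚ[i]
evalG (con c) z = c , 0ℚ
evalG X       z = z
evalG (p ⊕ q) z = evalG p z ⊞ evalG q z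
evalG (p ⊗ q) z = evalG p z ⊠ evalG q z

sample-eval : ∀ p n z → sample n (eval p z) ≡ evalG p (sample n z)
sample-eval (con c) n z = refl
sample-eval X       n z = refl
sample-eval (p ⊕ q) n z = cong₂ _⊞_ (sample-eval p n z) (sample-eval q n z)
sample-eval (p ⊗ q) n z = cong₂ _⊠_ (sample-eval p n z) (sample-eval q n z)

eval-cong : ∀ p {z w} → z ≈ w → eval p z ≈ eval p w
eval-cong (con c)         z≈w = ≈-refl {fromℚ c}
eval-cong X               z≈w = z≈w
eval-cong (p ⊕ q) {z} {w} z≈w =
  +-cong {eval p z} {eval p w} {eval q z} {eval q w} (eval-cong p z≈w) (eval-cong q z≈w)
eval-cong (p ⊗ q) {z} {w} z≈w =
  *-cong {eval p z} {eval p w} {eval q z} {eval q w} (eval-cong p z≈w) (eval-cong q z≈w)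

-- The cofactor of h² in the first-order Taylor expansion. The product clause collects everything
-- divisible by h² in (a + b h + h² c)(d + e h + h² f).
remainder : Poly → ℚ[i] → ℚ[i] → ℚ[i]
remainder (con c) z h = 0ℚ , 0ℚ
remainder X       z h = 0ℚ , 0ℚ
remainder (p ⊕ q) z h = remainder p z h ⊞ remainder q z h
remainder (p ⊗ q) z h =
  remainder p z h ⊠ (evalG q z ⊞ evalG (∂ q) z ⊠ h ⊞ h ⊠ h ⊠ remainder q z h)
  ⊞ evalG (∂ p) z ⊠ (evalG (∂ q) z ⊞ h ⊠ remainder q z h)
  ⊞ evalG p z ⊠ remainder q z h

taylor : ∀ p z h → evalG p (z ⊞ h) ≡ evalG p z ⊞ evalG (∂ p) z ⊠ h ⊞ h ⊠ h ⊠ remainder p z h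
taylor (con c) z h = G.solve 2 (λ c h → c G.:= c G.:+ G.con (0ℚ , 0ℚ) G.:* h G.:+ h G.:* h G.:* G.con (0ℚ , 0ℚ)) refl (c , 0ℚ) h
taylor X       z h = G.solve 2 (λ z h → z G.:+ h G.:= z G.:+ G.con (1ℚ , 0ℚ) G.:* h G.:+ h G.:* h G.:* G.con (0ℚ , 0ℚ)) refl z h
taylor (p ⊕ q) z h = trans (cong₂ _⊞_ (taylor p z h) (taylor q z h))
  (G.solve 7 (λ h a b c d e f →
    (a G.:+ b G.:* h G.:+ h G.:* h G.:* c) G.:+ (d G.:+ e G.:* h G.:+ h G.:* h G.:* f)
    G.:= (a G.:+ d) G.:+ (b G.:+ e) G.:* h G.:+ h G.:* h G.:* (c G.:+ f)) refl
    h (evalG p z) (evalG (∂ p) z) (remainder p z h) (evalG q z) (evalG (∂ q) z) (remainder q z h))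
taylor (p ⊗ q) z h = trans (cong₂ _⊠_ (taylor p z h) (taylor q z h))
  (G.solve 7 (λ h a b c d e f →
    (a G.:+ b G.:* h G.:+ h G.:* h G.:* c) G.:* (d G.:+ e G.:* h G.:+ h G.:* h G.:* f)
    G.:= a G.:* d G.:+ (b G.:* d G.:+ a G.:* e) G.:* h
      G.:+ h G.:* h G.:* (c G.:* (d G.:+ e G.:* h G.:+ h G.:* h G.:* f) G.:+ b G.:* (e G.:+ h G.:* f) G.:+ a G.:* f)) refl
    h (evalG p z) (evalG (∂ p) z) (remainder p z h) (evalG q z) (evalG (∂ q) z) (remainder q z h))

-- The bound is uniform in z and h because their samples vary with the index n, whereas δ has to be
-- chosen before n.
record LocallyBounded (F : ℚ[i] → ℚ[i] → ℚ[i]) : Set where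
  constructor locallyBounded
  field
    bound : ∀ M → 0ℚ ℚ.≤ M →
      ∃[ B ] 0ℚ ℚ.≤ B × (∀ z h → ∥ z ∥² ℚ.≤ M → ∥ h ∥² ℚ.≤ M → ∥ F z h ∥² ℚ.≤ B)
open LocallyBounded

bounded-const : ∀ c → LocallyBounded (λ _ _ → c)
bounded-const c = locallyBounded λ M _ → ∥ c ∥² , ∥∥²-nonneg c , λ _ _ _ _ → ℚₚ.≤-refl

bounded-⊞ : ∀ {F H} → LocallyBounded F → LocallyBounded H → LocallyBounded (λ z h → F z h ⊞ H z h)
bounded-⊞ {F} {H} bF bH = locallyBounded λ M 0≤M →
  let B , 0≤B , F≤B = bound bF M 0≤M
      C , 0≤C , H≤C = bound bH M 0≤M
  in (B ℚ.+ C) ℚ.+ (B ℚ.+ C) , 0≤-+ (0≤-+ 0≤B 0≤C) (0≤-+ 0≤B 0≤C) , λ z h z≤M h≤M →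
     let F+H≤B+C = ℚₚ.+-mono-≤ (F≤B z h z≤M h≤M) (H≤C z h z≤M h≤M)
     in ℚₚ.≤-trans (∥⊞∥²≤ (F z h) (H z h)) (ℚₚ.+-mono-≤ F+H≤B+C F+H≤B+C)

bounded-⊠ : ∀ {F H} → LocallyBounded F → LocallyBounded H → LocallyBounded (λ z h → F z h ⊠ H z h)
bounded-⊠ {F} {H} bF bH = locallyBounded λ M 0≤M →
  let B , 0≤B , F≤B = bound bF M 0≤M
      C , 0≤C , H≤C = bound bH M 0≤M
  in B ℚ.* C , 0≤-* 0≤B 0≤C , λ z h z≤M h≤M →
     subst (ℚ._≤ B ℚ.* C) (sym (∥⊠∥² (F z h) (H z h)))
       (*-mono-0≤ (∥∥²-nonneg (F z h)) (F≤B z h z≤M h≤M) (∥∥²-nonneg (H z h)) (H≤C z h z≤M h≤M))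

bounded-h : LocallyBounded (λ z h → h)
bounded-h = locallyBounded λ M 0≤M → M , 0≤M , λ _ _ _ h≤M → h≤M

bounded-evalG : ∀ p → LocallyBounded (λ z h → evalG p z)
bounded-evalG (con c) = bounded-const (c , 0ℚ)
bounded-evalG X       = locallyBounded λ M 0≤M → M , 0≤M , λ _ _ z≤M _ → z≤M
bounded-evalG (p ⊕ q) = bounded-⊞ (bounded-evalG p) (bounded-evalG q)
bounded-evalG (p ⊗ q) = bounded-⊠ (bounded-evalG p) (bounded-evalG q)

bounded-remainder : ∀ p → LocallyBounded (remainder p)
bounded-remainder (con c) = bounded-const (0ℚ , 0ℚ)
bounded-remainder X       = bounded-const (0ℚ , 0ℚ)
bounded-remainder (p ⊕ q) = bounded-⊞ (bounded-remainder p) (bounded-remainder q)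
bounded-remainder (p ⊗ q) = bounded-⊞ (bounded-⊞
  (bounded-⊠ (bounded-remainder p)
    (bounded-⊞ (bounded-⊞ (bounded-evalG q) (bounded-⊠ (bounded-evalG (∂ q)) bounded-h))
               (bounded-⊠ (bounded-⊠ bounded-h bounded-h) (bounded-remainder q))))
  (bounded-⊠ (bounded-evalG (∂ p)) (bounded-⊞ (bounded-evalG (∂ q)) (bounded-⊠ bounded-h (bounded-remainder q)))))
  (bounded-⊠ (bounded-evalG p) (bounded-remainder q))

polyFun : Poly → Fun Everywhere
polyFun p = record { at = λ z _ → eval p z ; at-cong = λ _ _ → eval-cong p }

-- The error is h² R with R the `remainder`. In squared moduli the goal is |h|⁴ |R|² ≤ ε² |h|², so
-- it suffices that |h|² |R|² ≤ ε².
poly-hasDerivative : ∀ p → HasDerivative (polyFun p) (polyFun (∂ p))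
poly-hasDerivative p z _ ε 0<ε =
  let Bᵣ , _ , re≤Bᵣ = cauchy-bound {seq (re z)} (cauchy (re z))
      Bᵢ , _ , im≤Bᵢ = cauchy-bound {seq (im z)} (cauchy (im z))
      M₀  = Bᵣ ℚ.* Bᵣ ℚ.+ Bᵢ ℚ.* Bᵢ
      ε²  = ε ℚ.* ε
      0≤M₀ = 0≤-+ (0≤p² Bᵣ) (0≤p² Bᵢ)
      0≤2ε² = 0≤-+ (0≤p² ε) (0≤p² ε)
      -- The radius covers both z, with |z|² ≤ M₀, and h, with |h|² ≤ 2δ² ≤ 2ε².
      B , 0≤B , R≤B = bound (bounded-remainder p) (M₀ ℚ.+ (ε² ℚ.+ ε²)) (0≤-+ 0≤M₀ 0≤2ε²)
      -- δ = ε/(1 + 2B), so that ε² = (1 + 2B)² δ² dominates both δ² and 2δ²B.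
      δ , 0<δ , ε≡ = split-ε {1ℚ ℚ.+ (B ℚ.+ B)} {ε} (ℚₚ.+-mono-<-≤ (ℚₚ.positive⁻¹ 1ℚ) (0≤-+ 0≤B 0≤B)) 0<ε
      δ²  = δ ℚ.* δ
      0<δ² = ℚₚ.positive⁻¹ δ² {{ℚₚ.pos*pos⇒pos δ {{ℚ.positive 0<δ}} δ {{ℚ.positive 0<δ}}}}
      0≤δ²B = 0≤-* (ℚₚ.<⇒≤ 0<δ²) 0≤B
      δ²≤ε² : δ² ℚ.≤ ε²
      δ²≤ε² = ≤-+ʳ (0≤-+ (0≤-+ 0≤δ²B 0≤δ²B) (0≤-+ (0≤-+ 0≤δ²B 0≤δ²B) (4δ²B²-nonneg δ B)))
                (trans (cong₂ ℚ._*_ ε≡ ε≡) (square δ B))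
      2δ²B≤ε² : (δ² ℚ.+ δ²) ℚ.* B ℚ.≤ ε²
      2δ²B≤ε² = ≤-+ʳ (0≤-+ (ℚₚ.<⇒≤ 0<δ²) (0≤-+ (0≤-+ 0≤δ²B 0≤δ²B) (4δ²B²-nonneg δ B)))
                (trans (cong₂ ℚ._*_ ε≡ ε≡) (square′ δ B))
  in δ , 0<δ , λ w _ h≤δ² ε′ 0<ε′ →
    eventually₂ (λ n (re≤ , im≤) h≤2δ² →
      let zₙ = sample n z
          h  = sample n w ⊟ zₙ
          R  = remainder p zₙ h
          z≤M₀ = ℚₚ.+-mono-≤ (∣p∣≤⇒p²≤ {seq (re z) n} re≤) (∣p∣≤⇒p²≤ {seq (im z) n} im≤)
          z≤M = ℚₚ.≤-trans z≤M₀ (≤-+ʳ 0≤2ε² refl)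
          h≤M = ℚₚ.≤-trans (ℚₚ.≤-trans h≤2δ² (ℚₚ.+-mono-≤ δ²≤ε² δ²≤ε²)) (≤-+ʳ 0≤M₀ (ℚₚ.+-comm M₀ (ε² ℚ.+ ε²)))
          hR≤ε² = ℚₚ.≤-trans (*-mono-0≤ (∥∥²-nonneg h) h≤2δ² (∥∥²-nonneg R) (R≤B zₙ h z≤M h≤M)) 2δ²B≤ε²
      in begin
        ∥ sample n (eval p w - eval p z - eval (∂ p) z * (w - z)) ∥²
          ≡⟨ cong ∥_∥² (difference n w) ⟩
        ∥ h ⊠ h ⊠ R ∥²
          ≡⟨ trans (∥⊠∥² (h ⊠ h) R) (cong (ℚ._* ∥ R ∥²) (∥⊠∥² h h)) ⟩
        ∥ h ∥² ℚ.* ∥ h ∥² ℚ.* ∥ R ∥²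
          ≡⟨ ℚₚ.*-assoc ∥ h ∥² ∥ h ∥² ∥ R ∥² ⟩
        ∥ h ∥² ℚ.* (∥ h ∥² ℚ.* ∥ R ∥²)
          ≤⟨ *-mono-0≤ (∥∥²-nonneg h) ℚₚ.≤-refl (0≤-* (∥∥²-nonneg h) (∥∥²-nonneg R)) hR≤ε² ⟩
        ∥ h ∥² ℚ.* ε²
          ≡⟨ ℚₚ.*-comm ∥ h ∥² ε² ⟩
        ε² ℚ.* ∥ h ∥²
          ≤⟨ ≤-+ʳ (ℚₚ.<⇒≤ 0<ε′) refl ⟩
        ε² ℚ.* ∥ h ∥² ℚ.+ ε′ ∎)
      -- A bound by `≤ᴿ` holds on samples only up to a tolerance; the tolerance δ² is chosen here,
      -- which gives |h|² ≤ 2δ² for late samples.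
      (eventually₂ (λ n → _,_) re≤Bᵣ im≤Bᵢ) (h≤δ² δ² 0<δ²)
  where
  open ℚₚ.≤-Reasoning
  module E = ≡-Reasoning
  4δ²B²-nonneg : ∀ δ B → 0ℚ ℚ.≤ (δ ℚ.* B ℚ.+ δ ℚ.* B) ℚ.* (δ ℚ.* B ℚ.+ δ ℚ.* B)
  4δ²B²-nonneg δ B = 0≤p² (δ ℚ.* B ℚ.+ δ ℚ.* B)
  square : ∀ δ B → let 2δ²B = δ ℚ.* δ ℚ.* B ℚ.+ δ ℚ.* δ ℚ.* B; 2δB = δ ℚ.* B ℚ.+ δ ℚ.* B in
    ((1ℚ ℚ.+ (B ℚ.+ B)) ℚ.* δ) ℚ.* ((1ℚ ℚ.+ (B ℚ.+ B)) ℚ.* δ) ≡ δ ℚ.* δ ℚ.+ (2δ²B ℚ.+ (2δ²B ℚ.+ 2δB ℚ.* 2δB))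
  square = Q.solve 2 (λ δ B → let 2δ²B = δ Q.:* δ Q.:* B Q.:+ δ Q.:* δ Q.:* B; 2δB = δ Q.:* B Q.:+ δ Q.:* B in
    ((Q.con 1ℚ Q.:+ (B Q.:+ B)) Q.:* δ) Q.:* ((Q.con 1ℚ Q.:+ (B Q.:+ B)) Q.:* δ)
    Q.:= δ Q.:* δ Q.:+ (2δ²B Q.:+ (2δ²B Q.:+ 2δB Q.:* 2δB))) refl
  square′ : ∀ δ B → let 2δ²B = δ ℚ.* δ ℚ.* B ℚ.+ δ ℚ.* δ ℚ.* B; 2δB = δ ℚ.* B ℚ.+ δ ℚ.* B in
    ((1ℚ ℚ.+ (B ℚ.+ B)) ℚ.* δ) ℚ.* ((1ℚ ℚ.+ (B ℚ.+ B)) ℚ.* δ) ≡ (δ ℚ.* δ ℚ.+ δ ℚ.* δ) ℚ.* B ℚ.+ (δ ℚ.* δ ℚ.+ (2δ²B ℚ.+ 2δB ℚ.* 2δB))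
  square′ = Q.solve 2 (λ δ B → let 2δ²B = δ Q.:* δ Q.:* B Q.:+ δ Q.:* δ Q.:* B; 2δB = δ Q.:* B Q.:+ δ Q.:* B in
    ((Q.con 1ℚ Q.:+ (B Q.:+ B)) Q.:* δ) Q.:* ((Q.con 1ℚ Q.:+ (B Q.:+ B)) Q.:* δ)
    Q.:= (δ Q.:* δ Q.:+ δ Q.:* δ) Q.:* B Q.:+ (δ Q.:* δ Q.:+ (2δ²B Q.:+ 2δB Q.:* 2δB))) refl
  difference : ∀ n w → let zₙ = sample n z; h = sample n w ⊟ zₙ in
    sample n (eval p w - eval p z - eval (∂ p) z * (w - z)) ≡ h ⊠ h ⊠ remainder p zₙ h
  difference n w = E.begin
    sample n (eval p w) ⊟ sample n (eval p z) ⊟ sample n (eval (∂ p) z) ⊠ h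
      E.≡⟨ cong₂ (λ a b → sample n (eval p w) ⊟ a ⊟ b ⊠ h) (sample-eval p n z) (sample-eval (∂ p) n z) ⟩
    sample n (eval p w) ⊟ a ⊟ b ⊠ h
      E.≡⟨ cong (λ v → v ⊟ a ⊟ b ⊠ h) (sample-eval p n w) ⟩
    evalG p (sample n w) ⊟ a ⊟ b ⊠ h
      E.≡⟨ cong (λ v → evalG p v ⊟ a ⊟ b ⊠ h) (G.solve 2 (λ w z → w G.:= z G.:+ (w G.:- z)) refl (sample n w) zₙ) ⟩
    evalG p (zₙ ⊞ h) ⊟ a ⊟ b ⊠ h
      E.≡⟨ cong (λ v → v ⊟ a ⊟ b ⊠ h) (taylor p zₙ h) ⟩
    a ⊞ b ⊠ h ⊞ h ⊠ h ⊠ remainder p zₙ h ⊟ a ⊟ b ⊠ h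
      E.≡⟨ G.solve 3 (λ a c d → a G.:+ c G.:+ d G.:- a G.:- c G.:= d) refl a (b ⊠ h) (h ⊠ h ⊠ remainder p zₙ h) ⟩
    h ⊠ h ⊠ remainder p zₙ h E.∎
    where
    zₙ = sample n z
    h = sample n w ⊟ zₙ
    a = evalG p zₙ
    b = evalG (∂ p) zₙ

-- The innermost derivative is taken first, so a derivative of order i + 1 of p is by definition one
-- of order i of `∂ p`; the inductions on the order below rely on this.
∂^ : ℕ → Poly → Poly
∂^ zero    p = p
∂^ (suc n) p = ∂^ n (∂ p)

polyEntire : Poly → Entire
polyEntire p = record { deriv = λ n → polyFun (∂^ n p) ; is-deriv = λ n → ∂^-hasDerivative n p }
  where
  ∂^-hasDerivative : ∀ n p → HasDerivative (polyFun (∂^ n p)) (polyFun (∂^ (suc n) p))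
  ∂^-hasDerivative zero    p = poly-hasDerivative p
  ∂^-hasDerivative (suc n) p = ∂^-hasDerivative n (∂ p)

A^ : Poly → ℕ → Poly → Poly
A^ u zero    f = f
A^ u (suc k) f = u ⊗ ∂ (A^ u k f)

A^-correct : ∀ u k f → A^[ polyFun u , k ] polyFun f ↦ polyFun (A^ u k f)
A^-correct u zero    f = A^0 (λ z _ → ≈-refl {eval f z})
A^-correct u (suc k) f =
  A^suc {g = polyFun (A^ u k f)} {g′ = polyFun (∂ (A^ u k f))} (A^-correct u k f) (poly-hasDerivative (A^ u k f)) (λ z _ → ≈-refl {eval (A^ u (suc k) f) z})

-- Derivatives at 0

at0 : Poly → ℚ
at0 (con c) = c
at0 X       = 0ℚ
at0 (p ⊕ q) = at0 p ℚ.+ at0 q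
at0 (p ⊗ q) = at0 p ℚ.* at0 q

sample-at0 : ∀ p n → sample n (eval p 0#) ≡ (at0 p , 0ℚ)
sample-at0 (con c) n = refl
sample-at0 X       n = refl
sample-at0 (p ⊕ q) n = cong₂ _⊞_ (sample-at0 p n) (sample-at0 q n)
sample-at0 (p ⊗ q) n = trans (cong₂ _⊠_ (sample-at0 p n) (sample-at0 q n)) (cong₂ _,_
  (Q.solve 2 (λ a b → a Q.:* b Q.:- Q.con 0ℚ Q.:* Q.con 0ℚ Q.:= a Q.:* b) refl (at0 p) (at0 q))
  (Q.solve 2 (λ a b → a Q.:* Q.con 0ℚ Q.:+ Q.con 0ℚ Q.:* b Q.:= Q.con 0ℚ) refl (at0 p) (at0 q)))

eval-0 : ∀ p → eval p 0# ≈ fromℚ (at0 p)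
eval-0 p = ≈-pointwise {eval p 0#} {fromℚ (at0 p)} (sample-at0 p)

-- Plain derivatives, not Taylor coefficients: in this normalisation eᶻ is the constant sequence 1
-- and zˢ/s! is `δ s`.
jet : Poly → ℕ → ℚ
jet p i = at0 (∂^ i p)

jet-⊕ : ∀ i p q → jet (p ⊕ q) i ≡ jet p i ℚ.+ jet q i
jet-⊕ zero    p q = refl
jet-⊕ (suc i) p q = jet-⊕ i (∂ p) (∂ q)

jet-con-⊗ : ∀ i c p → jet (con c ⊗ p) i ≡ c ℚ.* jet p i
jet-con-⊗ zero    c p = refl
jet-con-⊗ (suc i) c p = begin
  jet (con 0ℚ ⊗ p ⊕ con c ⊗ ∂ p) i             ≡⟨ jet-⊕ i (con 0ℚ ⊗ p) (con c ⊗ ∂ p) ⟩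
  jet (con 0ℚ ⊗ p) i ℚ.+ jet (con c ⊗ ∂ p) i   ≡⟨ cong₂ ℚ._+_ (jet-con-⊗ i 0ℚ p) (jet-con-⊗ i c (∂ p)) ⟩
  0ℚ ℚ.* jet p i ℚ.+ c ℚ.* jet (∂ p) i         ≡⟨ Q.solve 2 (λ a b → Q.con 0ℚ Q.:* a Q.:+ b Q.:= b) refl (jet p i) (c ℚ.* jet (∂ p) i) ⟩
  c ℚ.* jet (∂ p) i                            ∎
  where open ≡-Reasoning

-- In the Leibniz formula X contributes only its first derivative: its value at 0 and its higher
-- derivatives vanish.
jet-X-⊗ : ∀ i p → jet (X ⊗ p) (suc i) ≡ ι (suc i) ℚ.* jet p i
jet-X-⊗ i p = begin
  jet (con 1ℚ ⊗ p ⊕ X ⊗ ∂ p) i             ≡⟨ jet-⊕ i (con 1ℚ ⊗ p) (X ⊗ ∂ p) ⟩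
  jet (con 1ℚ ⊗ p) i ℚ.+ jet (X ⊗ ∂ p) i   ≡⟨ cong₂ ℚ._+_ (jet-con-⊗ i 1ℚ p) (lower i) ⟩
  1ℚ ℚ.* jet p i ℚ.+ ι i ℚ.* jet p i       ≡⟨ ℚₚ.*-distribʳ-+ (jet p i) 1ℚ (ι i) ⟨
  (1ℚ ℚ.+ ι i) ℚ.* jet p i                 ≡⟨ cong (ℚ._* jet p i) (ι-suc i) ⟨
  ι (suc i) ℚ.* jet p i                    ∎
  where
  open ≡-Reasoning
  lower : ∀ i → jet (X ⊗ ∂ p) i ≡ ι i ℚ.* jet p i
  lower zero    = trans (ℚₚ.*-zeroˡ (at0 (∂ p))) (sym (ℚₚ.*-zeroˡ (at0 p)))
  lower (suc i) = jet-X-⊗ i (∂ p)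

dividedPower : ℕ → Poly
dividedPower zero    = con 1ℚ
dividedPower (suc n) = con (recip (suc n)) ⊗ (X ⊗ dividedPower n)

jet-dividedPower : ∀ n i → jet (dividedPower n) i ≡ δ n i
jet-dividedPower zero    zero    = refl
jet-dividedPower zero    (suc i) = jet-0 i
  where
  jet-0 : ∀ i → jet (con 0ℚ) i ≡ 0ℚ
  jet-0 zero    = refl
  jet-0 (suc i) = jet-0 i
jet-dividedPower (suc n) zero    =
  trans (cong (recip (suc n) ℚ.*_) (ℚₚ.*-zeroˡ (at0 (dividedPower n)))) (ℚₚ.*-zeroʳ (recip (suc n)))
jet-dividedPower (suc n) (suc i) = begin
  jet (dividedPower (suc n)) (suc i)                         ≡⟨ jet-con-⊗ (suc i) (recip (suc n)) (X ⊗ dividedPower n) ⟩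
  recip (suc n) ℚ.* jet (X ⊗ dividedPower n) (suc i)         ≡⟨ cong (recip (suc n) ℚ.*_) (jet-X-⊗ i (dividedPower n)) ⟩
  recip (suc n) ℚ.* (ι (suc i) ℚ.* jet (dividedPower n) i)   ≡⟨ cong (λ c → recip (suc n) ℚ.* (ι (suc i) ℚ.* c)) (jet-dividedPower n i) ⟩
  recip (suc n) ℚ.* (ι (suc i) ℚ.* δ n i)                    ≡⟨ cancel (n ℕₚ.≟ i) ⟩
  δ n i                                                      ∎
  where
  open ≡-Reasoning
  cancel : Dec (n ≡ i) → recip (suc n) ℚ.* (ι (suc i) ℚ.* δ n i) ≡ δ n i
  cancel (yes refl) = begin
    recip (suc n) ℚ.* (ι (suc n) ℚ.* δ n n)   ≡⟨ ℚₚ.*-assoc (recip (suc n)) (ι (suc n)) (δ n n) ⟨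
    recip (suc n) ℚ.* ι (suc n) ℚ.* δ n n     ≡⟨ cong (ℚ._* δ n n) (trans (ℚₚ.*-comm (recip (suc n)) (ι (suc n))) (recip-inverse (suc n))) ⟩
    1ℚ ℚ.* δ n n                              ≡⟨ ℚₚ.*-identityˡ (δ n n) ⟩
    δ n n                                     ∎
  cancel (no n≢i) rewrite δ-off-diagonal n≢i = trans (cong (recip (suc n) ℚ.*_) (ℚₚ.*-zeroʳ (ι (suc i)))) (ℚₚ.*-zeroʳ (recip (suc n)))

truncatedExp : ℕ → Poly
truncatedExp zero    = dividedPower 0
truncatedExp (suc n) = truncatedExp n ⊕ dividedPower (suc n)

jet-truncatedExp : ∀ n i → i ≤ n → jet (truncatedExp n) i ≡ 1ℚ
jet-truncatedExp zero    .zero z≤n = refl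
jet-truncatedExp (suc n) i i≤1+n = begin
  jet (truncatedExp n ⊕ dividedPower (suc n)) i               ≡⟨ jet-⊕ i (truncatedExp n) (dividedPower (suc n)) ⟩
  jet (truncatedExp n) i ℚ.+ jet (dividedPower (suc n)) i     ≡⟨ cong (jet (truncatedExp n) i ℚ.+_) (jet-dividedPower (suc n) i) ⟩
  jet (truncatedExp n) i ℚ.+ δ (suc n) i                      ≡⟨ by-cases (ℕₚ.m≤n⇒m<n∨m≡n i≤1+n) ⟩
  1ℚ                                                          ∎
  where
  open ≡-Reasoning
  beyond : ∀ n i → n < i → jet (truncatedExp n) i ≡ 0ℚ
  beyond zero    (suc i) _   = jet-dividedPower zero (suc i)
  beyond (suc n) i       n<i = trans (jet-⊕ i (truncatedExp n) (dividedPower (suc n)))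
    (cong₂ ℚ._+_ (beyond n i (ℕₚ.<-trans ℕₚ.≤-refl n<i)) (trans (jet-dividedPower (suc n) i) (δ-off-diagonal (ℕₚ.<⇒≢ n<i))))
  by-cases : i < suc n ⊎ i ≡ suc n → jet (truncatedExp n) i ℚ.+ δ (suc n) i ≡ 1ℚ
  by-cases (inj₁ i<1+n) =
    cong₂ ℚ._+_ (jet-truncatedExp n i (ℕₚ.≤-pred i<1+n)) (δ-off-diagonal (ℕₚ.<⇒≢ i<1+n ∘ sym))
  by-cases (inj₂ refl)  = cong₂ ℚ._+_ (beyond n (suc n) ℕₚ.≤-refl) (δ-diagonal (suc n))

-- The action on the sequence of derivatives at 0 of d/dz and of multiplication by exp.

shift : (ℕ → ℚ) → ℕ → ℚ
shift g i = g (suc i)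

-- The rule (eᶻ g)′ = eᶻ g + eᶻ g′; unfolded, this is the binomial transform.
exp· : (ℕ → ℚ) → ℕ → ℚ
exp· g zero    = g zero
exp· g (suc i) = exp· g i ℚ.+ exp· (shift g) i

exp·-cong : ∀ i {f g} → (∀ j → j ≤ i → f j ≡ g j) → exp· f i ≡ exp· g i
exp·-cong zero    f≗g = f≗g 0 z≤n
exp·-cong (suc i) f≗g = cong₂ ℚ._+_ (exp·-cong i (λ j j≤i → f≗g j (ℕₚ.m≤n⇒m≤1+n j≤i)))
                                    (exp·-cong i (λ j j≤i → f≗g (suc j) (s≤s j≤i)))

exp·-+ : ∀ i f g → exp· (λ j → f j ℚ.+ g j) i ≡ exp· f i ℚ.+ exp· g i
exp·-+ zero    f g = refl
exp·-+ (suc i) f g = trans (cong₂ ℚ._+_ (exp·-+ i f g) (exp·-+ i (shift f) (shift g)))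
  (Q.solve 4 (λ a b c d → (a Q.:+ b) Q.:+ (c Q.:+ d) Q.:= (a Q.:+ c) Q.:+ (b Q.:+ d)) refl
    (exp· f i) (exp· g i) (exp· (shift f) i) (exp· (shift g) i))

-- By Leibniz, the i-th derivative of a product sees u only up to order i, where u agrees with eᶻ.
jet-exp : ∀ i u g → (∀ l → l ≤ i → jet u l ≡ 1ℚ) → jet (u ⊗ g) i ≡ exp· (jet g) i
jet-exp zero    u g u≡1 = trans (cong (ℚ._* at0 g) (u≡1 0 z≤n)) (ℚₚ.*-identityˡ (at0 g))
jet-exp (suc i) u g u≡1 = trans (jet-⊕ i (∂ u ⊗ g) (u ⊗ ∂ g)) (cong₂ ℚ._+_
  (jet-exp i (∂ u) g (λ l l≤i → u≡1 (suc l) (s≤s l≤i)))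
  (jet-exp i u (∂ g) (λ l l≤i → u≡1 l (ℕₚ.m≤n⇒m≤1+n l≤i))))

exp^· : ℕ → (ℕ → ℚ) → ℕ → ℚ
exp^· zero    g = g
exp^· (suc k) g = exp· (exp^· k g)

exp^·-0 : ∀ k g → exp^· k g 0 ≡ g 0
exp^·-0 zero    g = refl
exp^·-0 (suc k) g = exp^·-0 k g

exp^·-+ : ∀ k i f g → exp^· k (λ j → f j ℚ.+ g j) i ≡ exp^· k f i ℚ.+ exp^· k g i
exp^·-+ zero    i f g = refl
exp^·-+ (suc k) i f g = trans (exp·-cong i (λ j _ → exp^·-+ k j f g)) (exp·-+ i (exp^· k f) (exp^· k g))

exp^·-cong : ∀ k i {f g} → (∀ j → f j ≡ g j) → exp^· k f i ≡ exp^· k g i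
exp^·-cong zero    i f≗g = f≗g i
exp^·-cong (suc k) i f≗g = exp·-cong i (λ j _ → exp^·-cong k j f≗g)

-- d/dz (e^{kz} g) = e^{kz} (k g + g′).
shift-exp^· : ∀ k i g → shift (exp^· k g) i ≡ exp^· k (λ j → ι k ℚ.* g j ℚ.+ shift g j) i
shift-exp^· zero    i g = sym (trans (cong (ℚ._+ shift g i) (ℚₚ.*-zeroˡ (g i))) (ℚₚ.+-identityˡ (shift g i)))
shift-exp^· (suc k) i g = begin
  exp^· (suc k) g i ℚ.+ exp· (shift (exp^· k g)) i
    ≡⟨ cong (exp^· (suc k) g i ℚ.+_) (exp·-cong i (λ j _ → shift-exp^· k j g)) ⟩
  exp^· (suc k) g i ℚ.+ exp^· (suc k) (λ j → ι k ℚ.* g j ℚ.+ shift g j) i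
    ≡⟨ exp^·-+ (suc k) i g (λ j → ι k ℚ.* g j ℚ.+ shift g j) ⟨
  exp^· (suc k) (λ j → g j ℚ.+ (ι k ℚ.* g j ℚ.+ shift g j)) i
    ≡⟨ exp^·-cong (suc k) i (λ j → trans
         (Q.solve 3 (λ k a b → a Q.:+ (k Q.:* a Q.:+ b) Q.:= (Q.con 1ℚ Q.:+ k) Q.:* a Q.:+ b) refl (ι k) (g j) (shift g j))
         (cong (λ c → c ℚ.* g j ℚ.+ shift g j) (sym (ι-suc k)))) ⟩
  exp^· (suc k) (λ j → ι (suc k) ℚ.* g j ℚ.+ shift g j) i ∎
  where open ≡-Reasoning

-- The operator D (D + 1) ⋯ (D + k - 1) with D = d/dz.
rising : ℕ → (ℕ → ℚ) → ℕ → ℚ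
rising zero    f i = f i
rising (suc k) f i = ι k ℚ.* rising k f i ℚ.+ rising k f (suc i)

-- An operator with constant coefficients commutes with D.
rising-shift : ∀ k f i → rising k (shift f) i ≡ rising k f (suc i)
rising-shift zero    f i = refl
rising-shift (suc k) f i = cong₂ (λ a b → ι k ℚ.* a ℚ.+ b) (rising-shift k f i) (rising-shift k f (suc i))

rising-zero : ∀ k i → rising k (λ _ → 0ℚ) i ≡ 0ℚ
rising-zero zero    i = refl
rising-zero (suc k) i = trans (cong₂ (λ a b → ι k ℚ.* a ℚ.+ b) (rising-zero k i) (rising-zero k (suc i)))
  (trans (ℚₚ.+-identityʳ _) (ℚₚ.*-zeroʳ (ι k)))

rising-cong : ∀ k i {f g} → (∀ j → f j ≡ g j) → rising k f i ≡ rising k g i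
rising-cong zero    i f≗g = f≗g i
rising-cong (suc k) i f≗g = cong₂ (λ a b → ι k ℚ.* a ℚ.+ b) (rising-cong k i f≗g) (rising-cong k (suc i) f≗g)

-- A polynomial in D, applied to zˢ/s! and evaluated at 0, gives its coefficient of Dˢ. In the
-- induction D sends `δ (suc s)` to `δ s` and `δ 0` to 0.
rising-δ : ∀ k s → rising k (δ s) 0 ≡ stirling k s
rising-δ zero    zero    = refl
rising-δ zero    (suc s) = refl
rising-δ (suc k) zero    = cong₂ (λ a b → ι k ℚ.* a ℚ.+ b) (rising-δ k 0)
  (trans (sym (rising-shift k (δ 0) 0)) (rising-zero k 0))
rising-δ (suc k) (suc s) = cong₂ (λ a b → ι k ℚ.* a ℚ.+ b) (rising-δ k (suc s))
  (trans (sym (rising-shift k (δ (suc s)) 0)) (rising-δ k s))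

-- (e^z D)^k = e^{kz} D (D + 1) ⋯ (D + k - 1).
jet-A^ : ∀ N u → (∀ l → l ≤ N → jet u l ≡ 1ℚ) → ∀ k f i → k ℕ.+ i ≤ N → jet (A^ u k f) i ≡ exp^· k (rising k (jet f)) i
jet-A^ N u u≡1 zero    f i _       = refl
jet-A^ N u u≡1 (suc k) f i 1+k+i≤N = begin
  jet (u ⊗ ∂ (A^ u k f)) i
    ≡⟨ jet-exp i u (∂ (A^ u k f)) (λ l l≤i → u≡1 l (ℕₚ.≤-trans l≤i (ℕₚ.≤-trans (ℕₚ.m≤n+m i (suc k)) 1+k+i≤N))) ⟩
  exp· (shift (jet (A^ u k f))) i
    -- The derivative in A raises the order to j + 1 ≤ i + 1 while the exponent drops from k + 1 to
    -- k, so their sum stays within N.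
    ≡⟨ exp·-cong i (λ j j≤i → jet-A^ N u u≡1 k f (suc j) (ℕₚ.≤-trans (ℕₚ.+-monoʳ-≤ k (s≤s j≤i)) (subst (_≤ N) (sym (ℕₚ.+-suc k i)) 1+k+i≤N))) ⟩
  exp· (shift (exp^· k (rising k (jet f)))) i
    ≡⟨ exp·-cong i (λ j _ → shift-exp^· k j (rising k (jet f))) ⟩
  exp^· (suc k) (rising (suc k) (jet f)) i ∎
  where open ≡-Reasoning

at0-A^ : ∀ k s → at0 (A^ (truncatedExp k) k (dividedPower s)) ≡ stirling k s
at0-A^ k s = begin
  jet (A^ (truncatedExp k) k (dividedPower s)) 0
    ≡⟨ jet-A^ k (truncatedExp k) (jet-truncatedExp k) k (dividedPower s) 0 (ℕₚ.≤-reflexive (ℕₚ.+-identityʳ k)) ⟩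
  exp^· k (rising k (jet (dividedPower s))) 0   ≡⟨ exp^·-0 k (rising k (jet (dividedPower s))) ⟩
  rising k (jet (dividedPower s)) 0             ≡⟨ rising-cong k 0 (jet-dividedPower s) ⟩
  rising k (δ s) 0                              ≡⟨ rising-δ k s ⟩
  stirling k s                                  ∎
  where open ≡-Reasoning

-- Complex identities up to `_≈_` and finite complex sums

private
  module ℚ[i] = CommutativeRing ℚ[i]-commutativeRing

+-identityˡ : ∀ z → 0# + z ≈ z
+-identityˡ z = ≈-pointwise {0# + z} {z} (λ n → ℚ[i].+-identityˡ (sample n z))

+-identityʳ : ∀ z → z + 0# ≈ z
+-identityʳ z = ≈-pointwise {z + 0#} {z} (λ n → ℚ[i].+-identityʳ (sample n z))

*-identityˡ : ∀ z → 1# * z ≈ z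
*-identityˡ z = ≈-pointwise {1# * z} {z} (λ n → ℚ[i].*-identityˡ (sample n z))

*-identityʳ : ∀ z → z * 1# ≈ z
*-identityʳ z = ≈-pointwise {z * 1#} {z} (λ n → ℚ[i].*-identityʳ (sample n z))

*-zeroʳ : ∀ z → z * 0# ≈ 0#
*-zeroʳ z = ≈-pointwise {z * 0#} {0#} (λ n → ℚ[i].zeroʳ (sample n z))

fromℚ-cong : ∀ {p q} → p ≡ q → fromℚ p ≈ fromℚ q
fromℚ-cong {p} refl = ≈-refl {fromℚ p}

+≈0 : ∀ {z w} → z ≈ 0# → w ≈ 0# → z + w ≈ 0#
+≈0 {z} {w} z≈0 w≈0 = ≈-trans {z + w} {0# + 0#} {0#} (+-cong {z} {0#} {w} {0#} z≈0 w≈0) (+-identityˡ 0#)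

*≈0 : ∀ z {w} → w ≈ 0# → z * w ≈ 0#
*≈0 z {w} w≈0 = ≈-trans {z * w} {z * 0#} {0#} (*-cong {z} {z} {w} {0#} (≈-refl {z}) w≈0) (*-zeroʳ z)

*≈ˡ : ∀ {z w v} → z ≈ 1# → w ≈ v → z * w ≈ v
*≈ˡ {z} {w} {v} z≈1 w≈v = ≈-trans {z * w} {1# * v} {v} (*-cong {z} {1#} {w} {v} z≈1 w≈v) (*-identityˡ v)

*≈ʳ : ∀ {z w v} → z ≈ v → w ≈ 1# → z * w ≈ v
*≈ʳ {z} {w} {v} z≈v w≈1 = ≈-trans {z * w} {v * 1#} {v} (*-cong {z} {v} {w} {1#} z≈v w≈1) (*-identityʳ v)

^≈1 : ∀ n {z} → z ≈ 1# → z ^ n ≈ 1#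
^≈1 zero    {z} z≈1 = ≈-refl {1#}
^≈1 (suc n) {z} z≈1 = *≈ˡ {z} {z ^ n} {1#} z≈1 (^≈1 n z≈1)

∑-cong : ∀ (xs : List A) {f g : A → ℂ} → (∀ x → f x ≈ g x) → ∑ xs f ≈ ∑ xs g
∑-cong []       f≈g = ≈-refl {0#}
∑-cong (x ∷ xs) {f} {g} f≈g = +-cong {f x} {g x} {∑ xs f} {∑ xs g} (f≈g x) (∑-cong xs f≈g)

∑≈0 : ∀ (xs : List A) (f : A → ℂ) → All (λ x → f x ≈ 0#) xs → ∑ xs f ≈ 0#
∑≈0 []       f []             = ≈-refl {0#}
∑≈0 (x ∷ xs) f (fx≈0 ∷ fxs≈0) = +≈0 {f x} {∑ xs f} fx≈0 (∑≈0 xs f fxs≈0)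

∑-fromℚ : ∀ (xs : List A) f → ∑ xs (fromℚ ∘ f) ≈ fromℚ (∑ℚ xs f)
∑-fromℚ xs f = ≈-pointwise {∑ xs (fromℚ ∘ f)} {fromℚ (∑ℚ xs f)} (λ n → sample-∑ n xs)
  where
  sample-∑ : ∀ n xs → sample n (∑ xs (fromℚ ∘ f)) ≡ (∑ℚ xs f , 0ℚ)
  sample-∑ n []       = refl
  sample-∑ n (x ∷ xs) = cong ((f x , 0ℚ) ⊞_) (sample-∑ n xs)

∑-applyUpTo-single : ∀ (F : A → ℂ) (g : ℕ → A) {n i} → i < n → (∀ j → j ≢ i → F (g j) ≈ 0#) → ∑ (applyUpTo g n) F ≈ F (g i)
∑-applyUpTo-single F g {suc n} {zero} _ F≈0 =
  ≈-trans {F (g 0) + rest} {F (g 0) + 0#} {F (g 0)}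
    (+-cong {F (g 0)} {F (g 0)} {rest} {0#} (≈-refl {F (g 0)})
      (∑≈0 (applyUpTo (g ∘ suc) n) F (Allₚ.applyUpTo⁺₂ (g ∘ suc) n (λ j → F≈0 (suc j) λ ()))))
    (+-identityʳ (F (g 0)))
  where rest = ∑ (applyUpTo (g ∘ suc) n) F
∑-applyUpTo-single F g {suc n} {suc i} (s<s i<n) F≈0 =
  ≈-trans {F (g 0) + rest} {0# + F (g (suc i))} {F (g (suc i))}
    (+-cong {F (g 0)} {0#} {rest} {F (g (suc i))} (F≈0 0 λ ())
      (∑-applyUpTo-single F (g ∘ suc) i<n (λ j j≢i → F≈0 (suc j) (j≢i ∘ ℕₚ.suc-injective))))
    (+-identityˡ (F (g (suc i))))
  where rest = ∑ (applyUpTo (g ∘ suc) n) F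

-- The entries of α are exponents of the derivatives of orders i, ..., i + n - 1, and the last
-- hypothesis keeps these orders within N.
monomial≈1 : ∀ u N → (∀ l → l ≤ N → eval (∂^ l u) 0# ≈ 1#) →
             ∀ {n} i (α : Vec ℕ n) → i ℕ.+ n ≤ suc N → monomial (polyEntire u) i α 0# tt ≈ 1#
monomial≈1 u N u≈1 i []      _ = ≈-refl {1#}
monomial≈1 u N u≈1 {suc n} i (a ∷ α) i+n≤1+N =
  *≈ˡ {eval (∂^ i u) 0# ^ a} {monomial (polyEntire u) (suc i) α 0# tt} {1#}
    (^≈1 a (u≈1 i (ℕₚ.≤-trans (ℕₚ.m≤m+n i n) (ℕₚ.≤-pred 1+i+n≤1+N))))
    (monomial≈1 u N u≈1 (suc i) α 1+i+n≤1+N)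
  where
  1+i+n≤1+N : suc i ℕ.+ n ≤ suc N
  1+i+n≤1+N = subst (_≤ suc N) (ℕₚ.+-suc i n) i+n≤1+N

-- Boundary values of the Stirling numbers

stirling-< : ∀ {k s} → k < s → stirling k s ≡ 0ℚ
stirling-< {zero}  {suc s} _         = refl
stirling-< {suc k} {suc s} (s<s k<s) =
  trans (cong₂ (λ a b → ι k ℚ.* a ℚ.+ b) (stirling-< (ℕₚ.m≤n⇒m≤1+n k<s)) (stirling-< k<s))
        (trans (ℚₚ.+-identityʳ _) (ℚₚ.*-zeroʳ (ι k)))

stirling-diagonal : ∀ k → stirling k k ≡ 1ℚ
stirling-diagonal zero    = refl
stirling-diagonal (suc k) =
  trans (cong₂ (λ a b → ι k ℚ.* a ℚ.+ b) (stirling-< {k} ℕₚ.≤-refl) (stirling-diagonal k))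
        (cong (ℚ._+ 1ℚ) (ℚₚ.*-zeroʳ (ι k)))

stirling-0 : ∀ k → stirling (suc k) 0 ≡ 0ℚ
stirling-0 zero    = refl
stirling-0 (suc k) = trans (ℚₚ.+-identityʳ _) (trans (cong (ι (suc k) ℚ.*_) (stirling-0 k)) (ℚₚ.*-zeroʳ (ι (suc k))))

-- The operator identity evaluated at 0

module _ (C : Coefficients) (C-universal : IsUniversal C) where
  open IsUniversal C-universal

  -- Serves the case s = 0. The filter that defines `tuples` supplies the sum and weight equations
  -- required by `convention`.
  doubleSum-diagonal : ∀ k → 1 ≤ k → doubleSum C k k ≈ 0#
  doubleSum-diagonal k@(suc _) 1≤k =
    ∑≈0 (upTo k) (λ i → ∑ (tuples (suc i) k) (C k k (suc i))) (Allₚ.applyUpTo⁺₁ id k λ {i} i<k →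
      ∑≈0 (tuples (suc i) k) (C k k (suc i)) (All.map
        (λ {α} (∑α≡m , wα≡k) → convention k (suc i) 1≤k (s≤s z≤n) i<k α ∑α≡m wα≡k)
        (Allₚ.all-filter (λ α → (Vec.sum α ℕₚ.≟ suc i) ×-dec (weight 1 α ℕₚ.≟ k)) (vectorsUpTo (suc i) k))))

  -- Evaluating Aᵏ f at 0 for u = ∑_{i≤k} zⁱ/i! and f = zˢ/s! isolates the s-th coefficient,
  -- and all derivatives of u up to order k are 1 there.
  expansion-at-0 : ∀ k s j → 1 ≤ s → s < k → k ∸ s ≡ suc j →
    expansion C k (polyEntire (truncatedExp k)) (polyEntire (dividedPower s)) 0# tt ≈ doubleSum C k (suc j)
  expansion-at-0 k s j 1≤s s<k k∸s≡1+j =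
    ≈-trans {leading + lower} {0# + doubleSum C k (suc j)} {doubleSum C k (suc j)}
      (+-cong {leading} {0#} {lower} {doubleSum C k (suc j)} leading≈0 lower≈)
      (+-identityˡ (doubleSum C k (suc j)))
    where
    u = truncatedExp k
    f = dividedPower s
    u₀ = eval u 0#
    inner : ℕ → ℂ
    inner s′ = ∑[1… s′ ] (λ m → u₀ ^ (k ∸ m) * ∑ (tuples m s′) (λ α → C k s′ m α * monomial (polyEntire u) 1 α 0# tt))
    derivative : ℕ → ℂ
    derivative i = eval (∂^ i f) 0#
    term : ℕ → ℂ
    term i = inner (suc i) * derivative (k ∸ suc i)
    leading = u₀ ^ k * derivative k
    lower   = ∑[1… k ∸ 1 ] (λ s′ → inner s′ * derivative (k ∸ s′))

    derivative≈ : ∀ i → derivative i ≈ fromℚ (δ s i)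
    derivative≈ i = ≈-trans {derivative i} {fromℚ (jet f i)} {fromℚ (δ s i)}
      (eval-0 (∂^ i f)) (fromℚ-cong (jet-dividedPower s i))
    derivative≈0 : ∀ i → s ≢ i → derivative i ≈ 0#
    derivative≈0 i s≢i = ≈-trans {derivative i} {fromℚ (δ s i)} {0#} (derivative≈ i) (fromℚ-cong (δ-off-diagonal s≢i))
    u≈1 : ∀ l → l ≤ k → eval (∂^ l u) 0# ≈ 1#
    u≈1 l l≤k = ≈-trans {eval (∂^ l u) 0#} {fromℚ (jet u l)} {1#} (eval-0 (∂^ l u)) (fromℚ-cong (jet-truncatedExp k l l≤k))

    leading≈0 : leading ≈ 0#
    leading≈0 = *≈0 (u₀ ^ k) {derivative k} (derivative≈0 k (ℕₚ.<⇒≢ s<k))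

    k∸[1+j]≡s : k ∸ suc j ≡ s
    k∸[1+j]≡s = trans (cong (k ∸_) (sym k∸s≡1+j)) (ℕₚ.m∸[m∸n]≡n (ℕₚ.<⇒≤ s<k))
    1+j<k : suc j < k
    1+j<k = subst (_< k) k∸s≡1+j (ℕₚ.∸-monoʳ-< {k} 1≤s (ℕₚ.<⇒≤ s<k))

    other : ∀ i → i ≢ j → s ≢ k ∸ suc i
    other i i≢j s≡k∸[1+i] = i≢j (ℕₚ.suc-injective (begin
      suc i             ≡⟨ ℕₚ.m∸[m∸n]≡n 1+i≤k ⟨
      k ∸ (k ∸ suc i)   ≡⟨ cong (k ∸_) s≡k∸[1+i] ⟨
      k ∸ s             ≡⟨ k∸s≡1+j ⟩
      suc j             ∎))
      where
      open ≡-Reasoning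
      1+i≤k : suc i ≤ k
      -- Because `∸` truncates, recovering i + 1 from the difference requires i + 1 ≤ k. A vanishing
      -- difference is excluded by s ≥ 1.
      1+i≤k = ℕₚ.<⇒≤ (ℕₚ.m∸n≢0⇒n<m λ k∸[1+i]≡0 → ℕₚ.<⇒≢ 1≤s (sym (trans s≡k∸[1+i] k∸[1+i]≡0)))

    inner≈ : inner (suc j) ≈ doubleSum C k (suc j)
    inner≈ = ∑-cong (upTo (suc j)) {λ i → u₀ ^ (k ∸ suc i) * ∑ (ts i) (summand i)} {λ i → ∑ (ts i) (coefficient i)} λ i →
      *≈ˡ {u₀ ^ (k ∸ suc i)} {∑ (ts i) (summand i)} {∑ (ts i) (coefficient i)}
        (^≈1 (k ∸ suc i) {u₀} (u≈1 0 z≤n))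
        (∑-cong (ts i) {summand i} {coefficient i} λ α →
          *≈ʳ {coefficient i α} {monomial (polyEntire u) 1 α 0# tt} {coefficient i α}
            (≈-refl {coefficient i α}) (monomial≈1 u k u≈1 1 α (s≤s (ℕₚ.<⇒≤ 1+j<k))))
      where
      ts : ℕ → List (Vec ℕ (suc j))
      ts i = tuples (suc i) (suc j)
      coefficient summand : ℕ → Vec ℕ (suc j) → ℂ
      coefficient i α = C k (suc j) (suc i) α
      summand i α = coefficient i α * monomial (polyEntire u) 1 α 0# tt

    lower≈ : lower ≈ doubleSum C k (suc j)
    lower≈ = ≈-trans {lower} {term j} {doubleSum C k (suc j)}
      -- Position j of the list stands for s′ = j + 1, so the surviving term lies in range when j <
      -- k - 1, which amounts to s ≥ 1.
      (∑-applyUpTo-single term id (ℕₚ.<⇒≤pred 1+j<k)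
        (λ i i≢j → *≈0 (inner (suc i)) {derivative (k ∸ suc i)} (derivative≈0 (k ∸ suc i) (other i i≢j))))
      (*≈ʳ {inner (suc j)} {derivative (k ∸ suc j)} {doubleSum C k (suc j)} inner≈
        (≈-trans {derivative (k ∸ suc j)} {fromℚ (δ s (k ∸ suc j))} {1#} (derivative≈ (k ∸ suc j))
          (fromℚ-cong (trans (cong (δ s) k∸[1+j]≡s) (δ-diagonal s)))))

  doubleSum-stirling : ∀ k s → 1 ≤ s → s < k → doubleSum C k (k ∸ s) ≈ fromℚ (stirling k s)
  -- `doubleSum` branches on its last argument, so the difference is split first; s < k excludes the
  -- branch at 0.
  doubleSum-stirling k s 1≤s s<k with k ∸ s in k∸s≡
  ... | zero  = contradiction k∸s≡ (ℕₚ.m>n⇒m∸n≢0 s<k)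
  ... | suc j =
    ≈-trans {doubleSum C k (suc j)} {expanded} {fromℚ (stirling k s)}
      (≈-sym {expanded} {doubleSum C k (suc j)} (expansion-at-0 k s j 1≤s s<k k∸s≡))
      (≈-trans {expanded} {value} {fromℚ (stirling k s)}
        (≈-sym {value} {expanded}
          (entire k (ℕₚ.≤-trans 1≤s (ℕₚ.<⇒≤ s<k)) (polyEntire u) (polyEntire f) (polyFun (A^ u k f)) (A^-correct u k f) 0# tt))
        (≈-trans {value} {fromℚ (at0 (A^ u k f))} {fromℚ (stirling k s)} (eval-0 (A^ u k f)) (fromℚ-cong (at0-A^ k s))))
    where
    u = truncatedExp k
    f = dividedPower s
    value = eval (A^ u k f) 0#
    expanded = expansion C k (polyEntire u) (polyEntire f) 0# tt

corollary3p5 : (C : Coefficients) → IsUniversal C →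
    ∀ k s → 1 ≤ k → s ≤ k →
    ∑ (tuples s k) (λ α → fromℚ (cycleTerm k α)) ≈ doubleSum C k (k ∸ s)
corollary3p5 C C-universal k s 1≤k s≤k =
  ≈-trans {cycles} {fromℚ (stirling k s)} {doubleSum C k (k ∸ s)}
    (≈-trans {cycles} {fromℚ (∑ℚ (tuples s k) (cycleTerm k))} {fromℚ (stirling k s)}
      (∑-fromℚ (tuples s k) (cycleTerm k)) (fromℚ-cong (∑-cycleTerm k s)))
    (≈-sym {doubleSum C k (k ∸ s)} {fromℚ (stirling k s)} (by-cases s 1≤k (ℕₚ.m≤n⇒m<n∨m≡n s≤k)))
  where
  cycles = ∑ (tuples s k) (λ α → fromℚ (cycleTerm k α))
  by-cases : ∀ {k} s → 1 ≤ k → s < k ⊎ s ≡ k → doubleSum C k (k ∸ s) ≈ fromℚ (stirling k s)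
  -- Here k - s = k, where the convention makes all coefficients 0, in agreement with c(k,0) = 0 for
  -- k ≥ 1.
  by-cases {k} zero 1≤k@(s≤s {n = k-1} _) _ = ≈-trans {doubleSum C k k} {0#} {fromℚ (stirling k 0)}
    (doubleSum-diagonal C C-universal k 1≤k) (fromℚ-cong (sym (stirling-0 k-1)))
  by-cases s@(suc _) 1≤k (inj₁ s<k)  = doubleSum-stirling C C-universal _ s (s≤s z≤n) s<k
  -- Here k - s = 0, where the double sum is 1 by convention, as is c(k,k).
  by-cases s@(suc _) 1≤k (inj₂ refl) rewrite ℕₚ.n∸n≡0 s = fromℚ-cong (sym (stirling-diagonal s))
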